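{- Let $n\ge 3$ and $d\ge 2$ be integers. The automorphism group $\mathbb{T}_n^d$ of the cube $n^d$ is generated by $\mathbb{R}_d\cup\mathbb{F}_n\cup\mathbb{X}$. Moreover, the order of $\mathbb{T}_n^d$ is $2^{d-1+k}\,d!\,k!$, where $k=\lfloor n/2\rfloor$.
   Context: Let $[n]=\{0,\dots,n-1\}$. The combinatorial cube $n^d$ is the point set $[n]^d$. A set $\ell\subseteq[n]^d$ of $n$ distinct points is a line if its points can be ordered as $(q^1,\dots,q^n)$, $q^i=[q^i_1,\dots,q^i_d]$, such that for every coordinate $j\in\{1,\dots,d\}$ the sequence $(q^1_j,\dots,q^n_j)$ is strictly increasing, strictly decreasing, or constant, and at least one of these sequences is not constant. An automorphism of $n^d$ is a permutation $P$ of $[n]^d$ such that $P(\ell)$ is a line for every line $\ell$; $\mathbb{T}_n^d$ denotes the group of all automorphisms under composition. $\mathbb{R}_d$ is the group generated by the maps $R_{ij}$ ($i\neq j$ in $\{1,\dots,d\}$), where $R_{ij}$ sends $[x_1,\dots,x_d]$ to the point whose $i$-th coordinate is $n-x_j-1$, whose $j$-th coordinate is $x_i$, and whose other coordinates are unchanged. $\mathbb{F}_n$ is the group of maps $F_\pi([x_1,\dots,x_d])=[\pi(x_1),\dots,\pi(x_d)]$ where $\pi$ is a permutation of $[n]$ with the symmetry property: $\pi(p)=q$ implies $\pi(n-p-1)=n-q-1$. $\mathbb{X}=\{\mathit{Id},X\}$ where $X([x_1,\dots,x_{d-1},x_d])=[x_1,\dots,x_d,x_{d-1}]$. -}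

module Defs where

open import Level using (0ℓ)
open import Data.Nat using (ℕ; zero; suc)
open import Data.Fin using (Fin; opposite; _<_)
open import Data.Vec using (Vec; []; _∷_; lookup; map; _[_]≔_)
open import Data.Product using (Σ; ∃; _×_; _,_)
open import Data.Sum using (_⊎_)
open import Relation.Nullary using (¬_)
open import Relation.Binary.PropositionalEquality using (_≡_; _≢_)
open import Function using (_∘_; id; _⇔_)
open import Function.Definitions using (Injective)

-- Points of the combinatorial cube n^d : [n]^d, coordinates indexed 0..d-1
-- (coordinate j of the paper is index j-1 here).
Point : ℕ → ℕ → Set
Point n d = Vec (Fin n) d

PSet : ℕ → ℕ → Set₁
PSet n d = Point n d → Set

image : ∀ {n d} → (Point n d → Point n d) → PSet n d → PSet n d
image P ℓ y = ∃ λ x → ℓ x × P x ≡ y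

StrictlyIncreasing : ∀ {n} → (Fin n → Fin n) → Set
StrictlyIncreasing s = ∀ a b → a < b → s a < s b

StrictlyDecreasing : ∀ {n} → (Fin n → Fin n) → Set
StrictlyDecreasing s = ∀ a b → a < b → s b < s a

Constant : ∀ {n} → (Fin n → Fin n) → Set
Constant s = ∀ a b → s a ≡ s b

IsLineOrdering : ∀ {n d} → (Fin n → Point n d) → Set
IsLineOrdering {n} {d} q =
  Injective _≡_ _≡_ q
  × (∀ (j : Fin d) → let s = λ i → lookup (q i) j in
       StrictlyIncreasing s ⊎ StrictlyDecreasing s ⊎ Constant s)
  × (∃ λ (j : Fin d) → ¬ Constant (λ i → lookup (q i) j))

IsLine : ∀ {n d} → PSet n d → Set
IsLine {n} {d} ℓ = ∃ λ (q : Fin n → Point n d) →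
  IsLineOrdering q × (∀ x → ℓ x ⇔ (∃ λ i → q i ≡ x))

IsPermutation : ∀ {n d} → (Point n d → Point n d) → Set
IsPermutation {n} {d} P = ∃ λ (Q : Point n d → Point n d) →
  (∀ x → Q (P x) ≡ x) × (∀ x → P (Q x) ≡ x)

IsAut : ∀ {n d} → (Point n d → Point n d) → Set₁
IsAut {n} {d} P = IsPermutation P × (∀ (ℓ : PSet n d) → IsLine ℓ → IsLine (image P ℓ))

record Aut (n d : ℕ) : Set₁ where
  field
    fun   : Point n d → Point n d
    isAut : IsAut fun

R : ∀ {n d} → Fin d → Fin d → Point n d → Point n d
R i j x = (x [ i ]≔ opposite (lookup x j)) [ j ]≔ lookup x i

F : ∀ {n d} → (Fin n → Fin n) → Point n d → Point n d
F π = map π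

IsSymPerm : ∀ {n} → (Fin n → Fin n) → Set
IsSymPerm {n} π =
  (∃ λ (σ : Fin n → Fin n) → (∀ p → σ (π p) ≡ p) × (∀ p → π (σ p) ≡ p))
  × (∀ p q → π p ≡ q → π (opposite p) ≡ opposite q)

-- X swaps the last two coordinates (identity when d < 2; only used for d ≥ 2).
swapLast : ∀ {A : Set} {d} → Vec A d → Vec A d
swapLast []               = []
swapLast (a ∷ [])         = a ∷ []
swapLast (a ∷ b ∷ [])     = b ∷ a ∷ []
swapLast (a ∷ b ∷ c ∷ v) = a ∷ swapLast (b ∷ c ∷ v)

X : ∀ {n d} → Point n d → Point n d
X = swapLast

data Generator (n d : ℕ) : (Point n d → Point n d) → Set where
  gR  : ∀ i j → i ≢ j → Generator n d (R i j)
  gF  : ∀ π → IsSymPerm π → Generator n d (F π)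
  gId : Generator n d id
  gX  : Generator n d X

data Generated (n d : ℕ) : (Point n d → Point n d) → Set where
  base : ∀ {f} → Generator n d f → Generated n d f
  idG  : Generated n d id
  comp : ∀ {f g} → Generated n d f → Generated n d g → Generated n d (f ∘ g)
  inv  : ∀ {f g} → Generated n d f → (∀ x → g (f x) ≡ x) → (∀ x → f (g x) ≡ x)
       → Generated n d g

_≗ₚ_ : ∀ {n d} → (Point n d → Point n d) → (Point n d → Point n d) → Set
f ≗ₚ g = ∀ x → f x ≡ g x

HasOrder : ℕ → ℕ → ℕ → Set₁
HasOrder n d N = ∃ λ (e : Fin N → Aut n d) →
  (∀ a b → Aut.fun (e a) ≗ₚ Aut.fun (e b) → a ≡ b)
  × (∀ (P : Aut n d) → ∃ λ a → Aut.fun (e a) ≗ₚ Aut.fun P)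

{-# OPTIONS --safe #-}
module Submission where

-- A line is determined by a pattern: every coordinate is constant, or runs through [n] upwards or
-- downwards. Call a point central if it is the middle of the cube (n odd), or if all its coordinates
-- lie in one class {a, n-1-a} (n even). Every line through any other point has a counterpart with the
-- same running coordinates through a central point, but not conversely, so automorphisms preserve the
-- set of central points. A line through a central point is axis-parallel iff no other line M has, for every
-- non-central point x of it, two non-central points collinear with x; hence automorphisms permute the
-- axes through a central point. After composing with a signed permutation of the coordinates, an
-- automorphism therefore acts on the axes through a fixed central point by one permutation ρ of [n],
-- and collinearity forces it to agree with F_ρ on all points with coordinates in a single class.
-- From these points the agreement spreads to the whole cube, one coordinate at a time, because each
-- further point is cut out by two lines meeting the region already treated.

open import Defs
open import Data.Bool using (Bool; true; false; not; _xor_)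
open import Data.Bool.Properties using (xor-same)
open import Data.Empty using (⊥; ⊥-elim)
open import Data.Fin using (Fin; zero; suc; toℕ; fromℕ<; opposite; inject₁; inject≤; punchIn; _≟_; combine; remQuot; funToFin; finToFun; splitAt; join; _↑ˡ_; _↑ʳ_)
import Data.Fin as Fin
open import Data.Fin.Permutation using (Permutation′; permutation; insert; remove; insert-punchIn; insert-remove; _≈_; _⟨$⟩ʳ_; _⟨$⟩ˡ_; inverseˡ; inverseʳ)
import Data.Fin.Permutation as Perm
open import Data.Fin.Permutation.Components using (transpose; transpose-inverse)
open import Data.Fin.Permutation.Transposition.List using (TranspositionList; eval; decompose; eval-decompose)
open import Data.Fin.Properties using (suc-injective; toℕ-injective; toℕ<n; toℕ-fromℕ<; toℕ-inject₁; toℕ-inject≤; opposite-prop; opposite-involutive; pigeonhole; any?; finToFun-funToFin; funToFin-finToFin; remQuot-combine; combine-remQuot; punchIn-injective; join-splitAt; splitAt-↑ˡ; splitAt-↑ʳ)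
open import Data.List using ([]; _∷_)
open import Data.Nat using (ℕ; zero; suc; _≤_; _<_; z≤n; s≤s; _+_; _*_; _∸_; _^_; _!; _/_)
open import Data.Nat.DivMod using (_%_; m≡m%n+[m/n]*n; m%n<n)
open import Data.Nat.GeneralisedArithmetic using (fold)
import Data.Nat.Properties as ℕ
open import Data.Product using (Σ; ∃; _×_; _,_; proj₁; proj₂)
open import Data.Sum using (_⊎_; inj₁; inj₂)
open import Data.Vec using (Vec; []; _∷_; lookup; map; tabulate; replicate; _[_]≔_)
open import Data.Vec.Functional using (updateAt)
open import Data.Vec.Functional.Properties using (updateAt-updates; updateAt-minimal)
open import Data.Vec.Properties using (lookup∘tabulate; tabulate∘lookup; tabulate-cong; lookup∘update; lookup∘update′; lookup-map; lookup-replicate)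
open import Function using (_∘_; id; _⇔_; mk⇔; Equivalence)
open import Function.Definitions using (Injective)
open import Relation.Binary.PropositionalEquality using (_≡_; _≢_; _≗_; refl; sym; trans; cong; cong₂; subst; subst₂)
open import Relation.Nullary using (¬_; Dec; yes; no)
open import Relation.Nullary.Decidable using (_⊎-dec_; map′; ¬?; does; dec-false)

-- The recurring tool is `col-moved`: where two collinear points differ in two coordinates, these
-- lie in one class at each of the points. Lines through a point are never counted. For central p,
-- the lines through p are sent by the automorphism to lines through its image and from there back
-- to lines through p; this self-map of a finite set is injective, hence onto, so even the line
-- through p that runs in every coordinate has such a counterpart through the image of p. The bound
-- n ≥ 3 supplies a value outside the class of c (for n = 2 every point is central), and d ≥ 2
-- supplies a second coordinate against which such a value shows up as non-central. The order:
-- signed coordinate permutations contribute 2^d d!, symmetric permutations 2^k k!, with one bit for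
-- each pair {i, n-1-i}. Reflecting all coordinates at once occurs in both families, which removes
-- one factor 2.

private variable n d : ℕ

-- The orbit of x under h revisits a code; cancelling h backwards puts x itself in the image.
finite-onto : ∀ {X : Set} {N} (_≋_ : X → X → Set) (code : X → Fin N) →
  (∀ {x y} → code x ≡ code y → x ≋ y) →
  (h : X → X) → (∀ {x y} → h x ≋ h y → x ≋ y) → ∀ x → ∃ λ y → x ≋ h y
finite-onto {N = N} _≋_ code code-inj h h-inj x =
  let i , j , i<j , eq = pigeonhole (ℕ.n<1+n N) (λ i → code (fold x h (toℕ i)))
  in cancel (toℕ i) (toℕ j) i<j (code-inj eq)
  where
  cancel : ∀ i j → i < j → fold x h i ≋ fold x h j → ∃ λ y → x ≋ h y
  cancel zero    (suc j) _         e = fold x h j , e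
  cancel (suc i) (suc j) (s≤s i<j) e = cancel i j i<j (h-inj e)

injective⇒onto : (f : Fin n → Fin n) → Injective _≡_ _≡_ f → ∀ b → ∃ λ a → b ≡ f a
injective⇒onto f inj = finite-onto _≡_ id id f inj

lookup-ext : ∀ {A : Set} {x y : Vec A d} → (∀ j → lookup x j ≡ lookup y j) → x ≡ y
lookup-ext {x = x} {y} h = trans (sym (tabulate∘lookup x)) (trans (tabulate-cong h) (tabulate∘lookup y))

lookup-≢ : {x y : Point n d} → x ≢ y → ∃ λ j → lookup x j ≢ lookup y j
lookup-≢ {x = x} {y} x≢y with any? (λ j → ¬? (lookup x j ≟ lookup y j))
... | yes p = p
... | no ¬p = ⊥-elim (x≢y (lookup-ext λ j → agree j))
  where
  agree : ∀ j → lookup x j ≡ lookup y j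
  agree j with lookup x j ≟ lookup y j
  ... | yes e = e
  ... | no ¬e = ⊥-elim (¬p (j , ¬e))

-- Signs acting on [n] by reflection, and the classes {a, n-1-a}

infixr 8 _·_
_·_ : Bool → Fin n → Fin n
false · a = a
true  · a = opposite a

·-xor : ∀ u v (a : Fin n) → u · v · a ≡ (u xor v) · a
·-xor false v     a = refl
·-xor true  false a = refl
·-xor true  true  a = opposite-involutive a

·-self : ∀ v (a : Fin n) → v · v · a ≡ a
·-self false a = refl
·-self true  a = opposite-involutive a

·-injective : ∀ v {a b : Fin n} → v · a ≡ v · b → a ≡ b
·-injective v {a} {b} e = trans (sym (·-self v a)) (trans (cong (v ·_) e) (·-self v b))

·-move : ∀ v {a b : Fin n} → a ≡ v · b → v · a ≡ b
·-move v {b = b} e = trans (cong (v ·_) e) (·-self v b)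

·-comm-opposite : ∀ v (a : Fin n) → v · opposite a ≡ opposite (v · a)
·-comm-opposite false a = refl
·-comm-opposite true  a = refl

·-fixed : ∀ v {a : Fin n} → a ≡ opposite a → v · a ≡ a
·-fixed false e = refl
·-fixed true  e = sym e

·-fixed⁻ : ∀ v {a : Fin n} → v · a ≡ opposite (v · a) → a ≡ opposite a
·-fixed⁻ v {a} e = ·-injective v (trans e (sym (·-comm-opposite v a)))

sign-unique : ∀ u v {a : Fin n} → a ≢ opposite a → u · a ≡ v · a → u ≡ v
sign-unique false false _  _ = refl
sign-unique true  true  _  _ = refl
sign-unique false true  ne e = ⊥-elim (ne e)
sign-unique true  false ne e = ⊥-elim (ne (sym e))

-- A fixed value satisfies 2a + 1 = n, which determines a.
fixed-unique : {a b : Fin n} → a ≡ opposite a → b ≡ opposite b → a ≡ b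
fixed-unique {n} {a} {b} ea eb = toℕ-injective (double (toℕ a) (toℕ b) (trans (odd ea) (sym (odd eb))))
  where
  odd : {c : Fin n} → c ≡ opposite c → toℕ c + suc (toℕ c) ≡ n
  odd {c} e = trans (cong (_+ suc (toℕ c)) (trans (cong toℕ e) (opposite-prop c))) (ℕ.m∸n+n≡m (toℕ<n c))
  double : ∀ i j → i + suc i ≡ j + suc j → i ≡ j
  double zero    zero    e = refl
  double zero    (suc j) e with trans (ℕ.suc-injective e) (ℕ.+-suc j (suc j))
  ... | ()
  double (suc i) zero    e with trans (sym (ℕ.+-suc i (suc i))) (ℕ.suc-injective e)
  ... | ()
  double (suc i) (suc j) e = cong suc (double i j (ℕ.suc-injective
    (trans (sym (ℕ.+-suc i (suc i))) (trans (ℕ.suc-injective e) (ℕ.+-suc j (suc j))))))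

-- The sign is kept as data because it later becomes the sign of a running coordinate.
Same : Fin n → Fin n → Set
Same a b = ∃ λ v → a ≡ v · b

same-refl : {a : Fin n} → Same a a
same-refl = false , refl

same-sym : {a b : Fin n} → Same a b → Same b a
same-sym (v , e) = v , sym (·-move v e)

same-trans : {a b c : Fin n} → Same a b → Same b c → Same a c
same-trans {c = c} (u , e) (v , e′) = u xor v , trans e (trans (cong (u ·_) e′) (·-xor u v c))

same-· : ∀ v {a : Fin n} → Same (v · a) a
same-· v = v , refl

same? : (a b : Fin n) → Dec (Same a b)
same? a b = map′ (λ { (inj₁ e) → false , e ; (inj₂ e) → true , e })
                 (λ { (false , e) → inj₁ e ; (true , e) → inj₂ e })
                 (a ≟ b ⊎-dec a ≟ opposite b)

same-≢ : {a b : Fin n} → Same a b → a ≢ b → a ≡ opposite b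
same-≢ (false , e) ne = ⊥-elim (ne e)
same-≢ (true  , e) _  = e

outside-class : 3 ≤ n → (c : Fin n) → ∃ λ r → ¬ Same r c
outside-class (s≤s (s≤s (s≤s z≤n))) c with same? zero c
... | no ¬s = zero , ¬s
... | yes s = suc zero , λ s′ → one≁zero (same-trans s′ (same-sym s))
  where
  one≁zero : ∀ {m} → ¬ Same {suc (suc (suc m))} (suc zero) zero
  one≁zero (false , ())
  one≁zero (true , ())

zero-moved : 3 ≤ n → ∃ λ (t : Fin n) → t ≢ opposite t
zero-moved (s≤s (s≤s (s≤s z≤n))) = zero , λ ()

another : 2 ≤ d → (i : Fin d) → ∃ λ k → k ≢ i
another (s≤s (s≤s z≤n)) zero    = suc zero , λ ()
another (s≤s (s≤s z≤n)) (suc i) = zero , λ ()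

-- Lines as coordinate patterns

-- `inj₁ a` is a coordinate with constant value a; `inj₂ v` is a running one, upwards for `false`
-- and downwards for `true`. Flipping all running signs leaves the point set unchanged, so lines are
-- compared by `Line≈`.
Pattern : ℕ → ℕ → Set
Pattern n d = Fin d → Fin n ⊎ Bool

ev : Fin n ⊎ Bool → Fin n → Fin n
ev (inj₁ a) t = a
ev (inj₂ v) t = v · t

infix 4 _∈_
_∈_ : Point n d → Pattern n d → Set
x ∈ L = ∃ λ t → ∀ j → lookup x j ≡ ev (L j) t

Active : Pattern n d → Set
Active L = ∃ λ j → ∃ λ v → L j ≡ inj₂ v

pt : Pattern n d → Fin n → Point n d
pt L t = tabulate λ j → ev (L j) t

lookup-pt : (L : Pattern n d) (t : Fin n) → ∀ j → lookup (pt L t) j ≡ ev (L j) t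
lookup-pt L t = lookup∘tabulate (λ j → ev (L j) t)

pt-∈ : (L : Pattern n d) (t : Fin n) → pt L t ∈ L
pt-∈ L t = t , lookup-pt L t

param-unique : (L : Pattern n d) → Active L → ∀ {s t} → (∀ j → ev (L j) s ≡ ev (L j) t) → s ≡ t
param-unique L (j , v , e) h = ·-injective v (subst (λ l → ev l _ ≡ ev l _) e (h j))

Line≈ : Pattern n d → Pattern n d → Set
Line≈ L M = (∀ z → z ∈ L → z ∈ M) × (∀ z → z ∈ M → z ∈ L)

≗⇒Line≈ : {L M : Pattern n d} → L ≗ M → Line≈ L M
≗⇒Line≈ h = (λ { z (t , e) → t , λ j → trans (e j) (cong (λ l → ev l t) (h j)) }) ,
            (λ { z (t , e) → t , λ j → trans (e j) (cong (λ l → ev l t) (sym (h j))) })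

coord-code : Fin n ⊎ Bool → Fin (2 + n)
coord-code (inj₁ a)     = suc (suc a)
coord-code (inj₂ false) = zero
coord-code (inj₂ true)  = suc zero

coord-code-injective : (k l : Fin n ⊎ Bool) → coord-code k ≡ coord-code l → k ≡ l
coord-code-injective (inj₁ a)     (inj₁ b)     refl = refl
coord-code-injective (inj₂ false) (inj₂ false) _    = refl
coord-code-injective (inj₂ true)  (inj₂ true)  _    = refl
coord-code-injective (inj₁ a)     (inj₂ false) ()
coord-code-injective (inj₁ a)     (inj₂ true)  ()
coord-code-injective (inj₂ false) (inj₁ b)     ()
coord-code-injective (inj₂ true)  (inj₁ b)     ()
coord-code-injective (inj₂ false) (inj₂ true)  ()
coord-code-injective (inj₂ true)  (inj₂ false) ()

pattern-code : Pattern n d → Fin ((2 + n) ^ d)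
pattern-code L = funToFin (λ j → coord-code (L j))

pattern-code-injective : (L M : Pattern n d) → pattern-code L ≡ pattern-code M → L ≗ M
pattern-code-injective L M e j = coord-code-injective _ _
  (trans (sym (finToFun-funToFin _ j)) (trans (cong (λ c → finToFun c j) e) (finToFun-funToFin _ j)))

Col : Point n d → Point n d → Set
Col {n} {d} x y = ∃ λ (L : Pattern n d) → Active L × x ∈ L × y ∈ L

-- A coordinate in which the points differ must run, so at each point all such coordinates equal the
-- parameter up to sign.
col-moved : {x y : Point n d} → Col x y → ∀ {i j} → lookup x i ≢ lookup y i → lookup x j ≢ lookup y j →
  Same (lookup x i) (lookup x j) × Same (lookup y i) (lookup y j)
col-moved {x = x} {y} (L , _ , (s , es) , (t , et)) {i} {j} xi≢yi xj≢yj =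
  go (L i) (L j) (es i) (et i) (es j) (et j)
  where
  go : ∀ k l → lookup x i ≡ ev k s → lookup y i ≡ ev k t → lookup x j ≡ ev l s → lookup y j ≡ ev l t →
       Same (lookup x i) (lookup x j) × Same (lookup y i) (lookup y j)
  go (inj₁ a) l        e₁ e₂ e₃ e₄ = ⊥-elim (xi≢yi (trans e₁ (sym e₂)))
  go (inj₂ u) (inj₁ b) e₁ e₂ e₃ e₄ = ⊥-elim (xj≢yj (trans e₃ (sym e₄)))
  go (inj₂ u) (inj₂ v) e₁ e₂ e₃ e₄ =
    same-trans (u , e₁) (same-sym (v , e₃)) , same-trans (u , e₂) (same-sym (v , e₄))

line-constant : {L : Pattern n d} {x y z : Point n d} → x ∈ L → y ∈ L → x ≢ y → z ∈ L →
  ∀ i → lookup x i ≡ lookup y i → lookup z i ≡ lookup x i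
line-constant {L = L} {x} {y} (s , es) (t , et) x≢y (r , er) i e = go (L i) (es i) (et i) (er i)
  where
  go : ∀ k → lookup x i ≡ ev k s → lookup y i ≡ ev k t → _ ≡ ev k r → _ ≡ lookup x i
  go (inj₁ a) e₁ e₂ e₃ = trans e₃ (sym e₁)
  go (inj₂ v) e₁ e₂ e₃ = ⊥-elim (x≢y (lookup-ext λ j →
    trans (es j) (trans (cong (ev (L j)) (·-injective v (trans (sym e₁) (trans e e₂)))) (sym (et j)))))

-- Where x and y differ both patterns run, and the two signs there give the change of parameter δ.
-- One of the distinct parameters s, t is moved by reflection, and that one determines the sign at
-- every other running coordinate.
line-unique : {L M : Pattern n d} {x y : Point n d} → x ∈ L → y ∈ L → x ∈ M → y ∈ M → x ≢ y →
  ∀ z → z ∈ L → z ∈ M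
line-unique {n} {d} {L} {M} {x} {y} xL@(s , es) yL@(t , et) (s′ , es′) (t′ , et′) x≢y z zL@(r , er)
  with lookup-≢ x≢y
... | i , xi≢yi = go (L i) (M i) (es i) (et i) (es′ i) (et′ i)
  where
  go : ∀ k l → lookup x i ≡ ev k s → lookup y i ≡ ev k t → lookup x i ≡ ev l s′ → lookup y i ≡ ev l t′ → z ∈ M
  go (inj₁ a) l        e₁ e₂ e₃ e₄ = ⊥-elim (xi≢yi (trans e₁ (sym e₂)))
  go (inj₂ u) (inj₁ b) e₁ e₂ e₃ e₄ = ⊥-elim (xi≢yi (trans e₃ (sym e₄)))
  go (inj₂ u) (inj₂ v) e₁ e₂ e₃ e₄ = δ · r , λ j → step j (L j) (M j) (es j) (et j) (es′ j) (et′ j) (er j)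
    where
    δ = v xor u
    s′≡ : s′ ≡ δ · s
    s′≡ = trans (sym (·-move v (trans (sym e₁) e₃))) (·-xor v u s)
    t′≡ : t′ ≡ δ · t
    t′≡ = trans (sym (·-move v (trans (sym e₂) e₄))) (·-xor v u t)
    s≢t : s ≢ t
    s≢t refl = xi≢yi (trans e₁ (sym e₂))
    step : ∀ j k l → lookup x j ≡ ev k s → lookup y j ≡ ev k t → lookup x j ≡ ev l s′ → lookup y j ≡ ev l t′ →
           lookup z j ≡ ev k r → lookup z j ≡ ev l (δ · r)
    step j (inj₁ a) (inj₁ b) f₁ f₂ f₃ f₄ f₅ = trans f₅ (trans (sym f₁) f₃)
    step j (inj₁ a) (inj₂ w) f₁ f₂ f₃ f₄ f₅ =
      ⊥-elim (s≢t (·-injective δ (trans (sym s′≡) (trans (·-injective w (trans (sym f₃) (trans f₁ (trans (sym f₂) f₄)))) t′≡))))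
    step j (inj₂ w) (inj₁ b) f₁ f₂ f₃ f₄ f₅ = ⊥-elim (s≢t (·-injective w (trans (sym f₁) (trans f₃ (trans (sym f₄) f₂)))))
    step j (inj₂ w) (inj₂ w′) f₁ f₂ f₃ f₄ f₅ = trans f₅ (trans (cong (_· r) same-sign) (sym (·-xor w′ δ r)))
      where
      hs : w · s ≡ (w′ xor δ) · s
      hs = trans (sym f₁) (trans f₃ (trans (cong (w′ ·_) s′≡) (·-xor w′ δ s)))
      ht : w · t ≡ (w′ xor δ) · t
      ht = trans (sym f₂) (trans f₄ (trans (cong (w′ ·_) t′≡) (·-xor w′ δ t)))
      same-sign : w ≡ w′ xor δ
      same-sign with s ≟ opposite s | t ≟ opposite t
      ... | no ne  | _      = sign-unique w _ ne hs
      ... | yes _  | no ne  = sign-unique w _ ne ht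
      ... | yes se | yes te = ⊥-elim (s≢t (fixed-unique se te))

-- Monotone self-maps of [n]

opposite-< : {a b : Fin n} → a Fin.< b → opposite b Fin.< opposite a
opposite-< {n} {a} {b} a<b = subst₂ _<_ (sym (opposite-prop b)) (sym (opposite-prop a))
  (ℕ.∸-monoʳ-< (s≤s a<b) (toℕ<n b))

increasing-≥ : {s : Fin n → Fin n} → StrictlyIncreasing s → ∀ k a → toℕ a ≡ k → k ≤ toℕ (s a)
increasing-≥ inc zero    a       e = z≤n
increasing-≥ inc (suc k) (suc a) e = ℕ.≤-<-trans
  (increasing-≥ inc k (inject₁ a) (trans (toℕ-inject₁ a) (ℕ.suc-injective e)))
  (inc (inject₁ a) (suc a) (s≤s (ℕ.≤-reflexive (toℕ-inject₁ a))))

-- `increasing-≥` bounds s below by the identity; applied to s conjugated by reflection, it bounds s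
-- above.
increasing⇒id : {s : Fin n → Fin n} → StrictlyIncreasing s → ∀ a → s a ≡ a
increasing⇒id {n} {s} inc a = toℕ-injective (ℕ.≤-antisym (ℕ.≮⇒≥ not-above) (increasing-≥ inc _ a refl))
  where
  reflected : StrictlyIncreasing (opposite ∘ s ∘ opposite)
  reflected a b a<b = opposite-< (inc _ _ (opposite-< a<b))
  not-above : ¬ (toℕ a < toℕ (s a))
  not-above a<sa = ℕ.<⇒≱ (opposite-< a<sa)
    (subst (λ b → toℕ (opposite a) ≤ toℕ (opposite (s b))) (opposite-involutive a)
      (increasing-≥ reflected _ (opposite a) refl))

decreasing⇒opposite : {s : Fin n → Fin n} → StrictlyDecreasing s → ∀ a → s a ≡ opposite a
decreasing⇒opposite {s = s} dec a =
  trans (sym (opposite-involutive (s a))) (cong opposite (increasing⇒id (λ a b a<b → opposite-< (dec a b a<b)) a))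

-- Line-preserving maps and their inverses

Maps : (Point n d → Point n d) → Pattern n d → Pattern n d → Set
Maps f L M = (∀ x → x ∈ L → f x ∈ M) × (∀ y → y ∈ M → ∃ λ x → x ∈ L × f x ≡ y)

maps-reflect : {f : Point n d → Point n d} → (∀ {x y} → f x ≡ f y → x ≡ y) → (L L′ M M′ : Pattern n d) →
  Maps f L M → Maps f L′ M′ → (∀ z → z ∈ M → z ∈ M′) → ∀ z → z ∈ L → z ∈ L′
maps-reflect {f = f} f-inj _ L′ _ _ (into , _) (_ , onto′) sub z zL =
  let y , yL′ , fy≡fz = onto′ (f z) (sub (f z) (into z zL)) in subst (_∈ L′) (f-inj fy≡fz) yL′

PreservesLines : (Point n d → Point n d) → Set
PreservesLines f = ∀ L → Active L → ∃ λ M → Active M × Maps f L M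

record LineAut (n d : ℕ) : Set where
  field
    to from        : Point n d → Point n d
    from-to        : ∀ x → from (to x) ≡ x
    to-from        : ∀ x → to (from x) ≡ x
    to-preserves   : PreservesLines to
    from-preserves : PreservesLines from

  to-injective : ∀ {x y} → to x ≡ to y → x ≡ y
  to-injective {x} {y} e = trans (sym (from-to x)) (trans (cong from e) (from-to y))

  to-col : ∀ {x y} → Col x y → Col (to x) (to y)
  to-col (L , act , xL , yL) = let M , act′ , into , _ = to-preserves L act in M , act′ , into _ xL , into _ yL

inverse : LineAut n d → LineAut n d
inverse f = record
  { to = from ; from = to ; from-to = to-from ; to-from = from-to
  ; to-preserves = from-preserves ; from-preserves = to-preserves }
  where open LineAut f

preserves-∘ : {f g : Point n d → Point n d} → PreservesLines f → PreservesLines g → PreservesLines (f ∘ g)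
preserves-∘ {f = f} pf pg L act =
  let M , actM , M-into , M-onto = pg L act
      K , actK , K-into , K-onto = pf M actM
  in K , actK , (λ x xL → K-into _ (M-into x xL)) ,
     λ z zK → let y , yM , fy≡z = K-onto z zK
                  x , xL , gx≡y = M-onto y yM
              in x , xL , trans (cong f gx≡y) fy≡z

infixr 9 _∘ᴸ_
_∘ᴸ_ : LineAut n d → LineAut n d → LineAut n d
f ∘ᴸ g = record
  { to = F.to ∘ G.to ; from = G.from ∘ F.from
  ; from-to = λ x → trans (cong G.from (F.from-to (G.to x))) (G.from-to x)
  ; to-from = λ x → trans (cong F.to (G.to-from (F.from x))) (F.to-from x)
  ; to-preserves = preserves-∘ F.to-preserves G.to-preserves
  ; from-preserves = preserves-∘ G.from-preserves F.from-preserves }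
  where
  module F = LineAut f
  module G = LineAut g

-- The map induced on lines inherits injectivity from f. There are finitely many patterns, so it is
-- onto: every line is the image of a line.
inverse-preserves : {f g : Point n d → Point n d} → (∀ x → g (f x) ≡ x) → (∀ x → f (g x) ≡ x) →
  PreservesLines f → PreservesLines g
inverse-preserves {n} {d} {f} {g} gf fg pres L act =
  let (L₀ , act₀) , (into , onto) = finite-onto _≋_ code
        (λ {L} {M} e → ≗⇒Line≈ (pattern-code-injective (proj₁ L) (proj₁ M) e)) h (λ {L} {M} → h-injective L M) (L , act)
      M , _ , M-into , M-onto = pres L₀ act₀
  in L₀ , act₀ ,
     (λ x xL → let y , yL₀ , fy≡x = M-onto x (into x xL) in subst (_∈ L₀) (trans (sym (gf y)) (cong g fy≡x)) yL₀) ,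
     (λ y yL₀ → f y , onto (f y) (M-into y yL₀) , gf y)
  where
  Line = Σ (Pattern n d) Active
  f-injective : ∀ {x y} → f x ≡ f y → x ≡ y
  f-injective {x} {y} e = trans (sym (gf x)) (trans (cong g e) (gf y))
  _≋_ : Line → Line → Set
  (L , _) ≋ (M , _) = Line≈ L M
  code : Line → Fin ((2 + n) ^ d)
  code (L , _) = pattern-code L
  h : Line → Line
  h (L , act) = let M , act′ , _ = pres L act in M , act′
  h-injective : ∀ L M → h L ≋ h M → L ≋ M
  h-injective (L , actL) (M , actM) (sub , sup) =
    let L′ , _ , mapsL = pres L actL
        M′ , _ , mapsM = pres M actM
    in maps-reflect f-injective L M L′ M′ mapsL mapsM sub , maps-reflect f-injective M L M′ L′ mapsM mapsL sup

-- Patterns and lines as sets of points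

pattern-ordering : 3 ≤ n → (L : Pattern n d) → Active L → IsLineOrdering (pt L)
pattern-ordering n≥3 L act@(j₀ , v , e₀) =
  (λ {s} {t} e → param-unique L act λ j → trans (sym (lookup-pt L s j)) (trans (cong (λ x → lookup x j) e) (lookup-pt L t j))) ,
  (λ j → monotone j (L j) (λ t → lookup-pt L t j)) ,
  j₀ , λ const → let t , t≢ = zero-moved n≥3 in
    t≢ (·-injective v (trans (sym (subst (λ l → lookup (pt L t) j₀ ≡ ev l t) e₀ (lookup-pt L t j₀)))
      (trans (const t (opposite t)) (subst (λ l → lookup (pt L (opposite t)) j₀ ≡ ev l (opposite t)) e₀ (lookup-pt L (opposite t) j₀)))))
  where
  monotone : ∀ j k → (∀ t → lookup (pt L t) j ≡ ev k t) →
    let s = λ t → lookup (pt L t) j in StrictlyIncreasing s ⊎ StrictlyDecreasing s ⊎ Constant s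
  monotone j (inj₁ a)     h = inj₂ (inj₂ λ s t → trans (h s) (sym (h t)))
  monotone j (inj₂ false) h = inj₁ λ s t s<t → subst₂ Fin._<_ (sym (h s)) (sym (h t)) s<t
  monotone j (inj₂ true)  h = inj₂ (inj₁ λ s t s<t → subst₂ Fin._<_ (sym (h t)) (sym (h s)) (opposite-< s<t))

ordering-pattern : 3 ≤ n → {q : Fin n → Point n d} → IsLineOrdering q →
  ∃ λ (L : Pattern n d) → Active L × (∀ t j → lookup (q t) j ≡ ev (L j) t)
ordering-pattern {n} {d} n≥3 {q} (_ , monotone , j₀ , ¬const) =
  (λ j → proj₁ (coord j)) , (j₀ , active (coord j₀)) , λ t j → proj₂ (coord j) t
  where
  coord : ∀ j → ∃ λ (k : Fin n ⊎ Bool) → ∀ t → lookup (q t) j ≡ ev k t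
  coord j with monotone j
  ... | inj₁ inc         = inj₂ false , increasing⇒id inc
  ... | inj₂ (inj₁ dec)  = inj₂ true , decreasing⇒opposite dec
  -- The constant value may be read at any parameter; `zero-moved` just provides one.
  ... | inj₂ (inj₂ con)  = inj₁ (lookup (q (proj₁ (zero-moved n≥3))) j) , λ t → con t _
  active : (k : ∃ λ (k : Fin n ⊎ Bool) → ∀ t → lookup (q t) j₀ ≡ ev k t) → ∃ λ v → proj₁ k ≡ inj₂ v
  active (inj₁ a , h) = ⊥-elim (¬const λ s t → trans (h s) (sym (h t)))
  active (inj₂ v , h) = v , refl

∈⇔pt : {L : Pattern n d} {q : Fin n → Point n d} → (∀ t j → lookup (q t) j ≡ ev (L j) t) →
  ∀ x → (x ∈ L) ⇔ (∃ λ t → q t ≡ x)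
∈⇔pt {L = L} h x = mk⇔ (λ { (t , e) → t , lookup-ext λ j → trans (h t j) (sym (e j)) })
                       (λ { (t , refl) → t , h t })

isAut⇒preserves : 3 ≤ n → {f : Point n d → Point n d} → IsAut f → PreservesLines f
isAut⇒preserves n≥3 {f} (_ , lines) L act =
  let q , ord , iff = lines (_∈ L) (pt L , pattern-ordering n≥3 L act , ∈⇔pt {L = L} (lookup-pt L))
      M , act′ , h = ordering-pattern n≥3 ord
      open Equivalence
  in M , act′ ,
     (λ x xL → from (∈⇔pt {L = M} h (f x)) (to (iff (f x)) (x , xL , refl))) ,
     (λ y yM → from (iff y) (to (∈⇔pt {L = M} h y) yM))

preserves⇒isAut : 3 ≤ n → {f : Point n d → Point n d} → IsPermutation f → PreservesLines f → IsAut f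
preserves⇒isAut n≥3 {f} perm pres = perm , λ ℓ (q , ord , iff) →
  let L , act , h = ordering-pattern n≥3 ord
      M , act′ , into , onto = pres L act
      open Equivalence
      ℓ⇒L : ∀ x → ℓ x → x ∈ L
      ℓ⇒L x ℓx = from (∈⇔pt {L = L} h x) (to (iff x) ℓx)
      L⇒ℓ : ∀ x → x ∈ L → ℓ x
      L⇒ℓ x xL = from (iff x) (to (∈⇔pt {L = L} h x) xL)
  in pt M , pattern-ordering n≥3 M act′ , λ y → mk⇔
       (λ (x , ℓx , fx≡y) → to (∈⇔pt {L = M} (lookup-pt M) y) (subst (_∈ M) fx≡y (into x (ℓ⇒L x ℓx))))
       (λ e → let x , xL , fx≡y = onto y (from (∈⇔pt {L = M} (lookup-pt M) y) e) in x , L⇒ℓ x xL , fx≡y)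

isAut⇒LineAut : 3 ≤ n → {f : Point n d → Point n d} → IsAut f → LineAut n d
isAut⇒LineAut n≥3 {f} aut@((g , gf , fg) , _) = record
  { to = f ; from = g ; from-to = gf ; to-from = fg
  ; to-preserves = pres ; from-preserves = inverse-preserves gf fg pres }
  where pres = isAut⇒preserves n≥3 aut

LineAut⇒isAut : 3 ≤ n → (f : LineAut n d) → IsAut (LineAut.to f)
LineAut⇒isAut n≥3 f = preserves⇒isAut n≥3 (from , from-to , to-from) to-preserves
  where open LineAut f

-- Signed coordinate permutations and symmetric permutations of the values

-- Stated for every f with these coordinates, so that it covers `R i j` and `X` as well as `signed`.
signed-preserves : (ε : Fin d → Bool) (τ τ⁻ : Fin d → Fin d) → (∀ j → τ (τ⁻ j) ≡ j) →
  {f : Point n d → Point n d} → (∀ x j → lookup (f x) j ≡ ε j · lookup x (τ j)) → PreservesLines f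
signed-preserves {d} {n} ε τ τ⁻ ττ⁻ {f} h L (j₀ , v , e₀) =
  M , (τ⁻ j₀ , ε (τ⁻ j₀) xor v , cong (turn (ε (τ⁻ j₀))) (trans (cong L (ττ⁻ j₀)) e₀)) ,
  (λ x (t , e) → t , moved x t e) ,
  λ y (t , e) → pt L t , pt-∈ L t , lookup-ext λ j → trans (moved (pt L t) t (lookup-pt L t) j) (sym (e j))
  where
  turn : Bool → Fin n ⊎ Bool → Fin n ⊎ Bool
  turn u (inj₁ a) = inj₁ (u · a)
  turn u (inj₂ v) = inj₂ (u xor v)
  ev-turn : ∀ u k t → u · ev k t ≡ ev (turn u k) t
  ev-turn u (inj₁ a) t = refl
  ev-turn u (inj₂ v) t = ·-xor u v t
  M : Pattern n d
  M j = turn (ε j) (L (τ j))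
  moved : ∀ x t → (∀ j → lookup x j ≡ ev (L j) t) → ∀ j → lookup (f x) j ≡ ev (M j) t
  moved x t e j = trans (h x j) (trans (cong (ε j ·_) (e (τ j))) (ev-turn (ε j) (L (τ j)) t))

signed : (ε : Fin d → Bool) (τ : Fin d → Fin d) → Point n d → Point n d
signed ε τ x = tabulate λ j → ε j · lookup x (τ j)

lookup-signed : (ε : Fin d → Bool) (τ : Fin d → Fin d) (x : Point n d) →
  ∀ j → lookup (signed ε τ x) j ≡ ε j · lookup x (τ j)
lookup-signed ε τ x = lookup∘tabulate λ j → ε j · lookup x (τ j)

signedAut : (ε : Fin d → Bool) (τ τ⁻ : Fin d → Fin d) → (∀ j → τ (τ⁻ j) ≡ j) → (∀ j → τ⁻ (τ j) ≡ j) → LineAut n d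
signedAut ε τ τ⁻ ττ⁻ τ⁻τ = record
  { to = signed ε τ ; from = signed ε⁻ τ⁻
  ; from-to = λ x → lookup-ext λ j → trans (lookup-signed ε⁻ τ⁻ (signed ε τ x) j)
      (trans (cong (ε⁻ j ·_) (lookup-signed ε τ x (τ⁻ j))) (trans (·-self (ε (τ⁻ j)) _) (cong (lookup x) (ττ⁻ j))))
  ; to-from = λ x → lookup-ext λ j → trans (lookup-signed ε τ (signed ε⁻ τ⁻ x) j)
      (trans (cong (ε j ·_) (lookup-signed ε⁻ τ⁻ x (τ j)))
      (trans (cong (λ k → ε j · ε k · lookup x (τ⁻ (τ j))) (τ⁻τ j)) (trans (·-self (ε j) _) (cong (lookup x) (τ⁻τ j)))))
  ; to-preserves = signed-preserves ε τ τ⁻ ττ⁻ (lookup-signed ε τ)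
  ; from-preserves = signed-preserves ε⁻ τ⁻ τ τ⁻τ (lookup-signed ε⁻ τ⁻) }
  where ε⁻ = λ j → ε (τ⁻ j)

symPerm-· : {π : Fin n → Fin n} → IsSymPerm π → ∀ v a → π (v · a) ≡ v · π a
symPerm-· _           false a = refl
symPerm-· (_ , symm) true  a = symm a _ refl

symPerm-inverse : {π : Fin n → Fin n} (s : IsSymPerm π) → IsSymPerm (proj₁ (proj₁ s))
symPerm-inverse {π = π} s@((σ , σπ , πσ) , symm) = (π , πσ , σπ) , λ { p _ refl →
  trans (cong (σ ∘ opposite) (sym (πσ p))) (trans (cong σ (sym (symm (σ p) _ refl))) (σπ _)) }

-- π commutes with signs, so v · t becomes v · π t: running coordinates keep their signs and only
-- the parameter is renamed.
F-preserves : {π : Fin n → Fin n} → IsSymPerm π → PreservesLines {n} {d} (F π)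
F-preserves {n} {d} {π} s@((σ , σπ , πσ) , _) L (j₀ , v , e₀) =
  M , (j₀ , v , cong turn e₀) ,
  (λ x (t , e) → π t , moved x t e) ,
  λ y (t , e) → pt L (σ t) , pt-∈ L (σ t) , lookup-ext λ j →
    trans (moved (pt L (σ t)) (σ t) (lookup-pt L (σ t)) j) (trans (cong (ev (M j)) (πσ t)) (sym (e j)))
  where
  turn : Fin n ⊎ Bool → Fin n ⊎ Bool
  turn (inj₁ a) = inj₁ (π a)
  turn (inj₂ v) = inj₂ v
  M : Pattern n d
  M j = turn (L j)
  ev-turn : ∀ k t → π (ev k t) ≡ ev (turn k) (π t)
  ev-turn (inj₁ a) t = refl
  ev-turn (inj₂ v) t = symPerm-· s v t
  moved : ∀ x t → (∀ j → lookup x j ≡ ev (L j) t) → ∀ j → lookup (F π x) j ≡ ev (M j) (π t)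
  moved x t e j = trans (lookup-map j π x) (trans (cong π (e j)) (ev-turn (L j) t))

FAut : {π : Fin n → Fin n} → IsSymPerm π → LineAut n d
FAut {π = π} s@((σ , σπ , πσ) , _) = record
  { to = F π ; from = F σ
  ; from-to = λ x → lookup-ext λ j → trans (lookup-map j σ (F π x)) (trans (cong σ (lookup-map j π x)) (σπ _))
  ; to-from = λ x → lookup-ext λ j → trans (lookup-map j π (F σ x)) (trans (cong π (lookup-map j σ x)) (πσ _))
  ; to-preserves = F-preserves s
  ; from-preserves = F-preserves (symPerm-inverse s) }

-- Central points and their invariance

-- For even n every value is a candidate, for odd n only the middle one.
Candidate : Fin n → Set
Candidate {n} c = ∀ (b : Fin n) → b ≡ opposite b → c ≡ opposite c

candidate-same : {a b : Fin n} → Same a b → Candidate b → Candidate a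
candidate-same (v , refl) cand m e = trans (cong (v ·_) (cand m e)) (·-comm-opposite v _)

-- The points lying on the largest number of lines.
record Central (x : Point n d) : Set where
  constructor central
  field
    one-class  : ∀ i j → Same (lookup x i) (lookup x j)
    candidates : ∀ i → Candidate (lookup x i)
open Central

central-resp : {x y : Point n d} → (∀ j → Same (lookup y j) (lookup x j)) → Central x → Central y
central-resp s (central same cand) = central
  (λ i j → same-trans (s i) (same-trans (same i j) (same-sym (s j)))) λ i → candidate-same (s i) (cand i)

-- If t were fixed by reflection, the candidate c would be fixed too, and fixed values are unique.
outside-moved : {c t : Fin n} → Candidate c → ¬ Same t c → t ≢ opposite t
outside-moved cand ¬s e = ¬s (false , fixed-unique e (cand _ e))

-- Agreement up to the change of parameter δ with the constant values left free; a common point then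
-- identifies these.
data Parallel {n} (δ : Bool) : Fin n ⊎ Bool → Fin n ⊎ Bool → Set where
  both-constant : ∀ {a b} → Parallel δ (inj₁ a) (inj₁ b)
  both-running  : ∀ {u v} → (∀ (r : Fin n) → u · r ≡ v · δ · r) → Parallel {n} δ (inj₂ u) (inj₂ v)

parallel-sym : ∀ {δ} {k l : Fin n ⊎ Bool} → Parallel δ k l → Parallel δ l k
parallel-sym both-constant = both-constant
parallel-sym {δ = δ} (both-running {u} {v} h) =
  both-running λ r → sym (trans (h (δ · r)) (cong (v ·_) (·-self δ r)))

parallel-⊆ : ∀ {δ} {L M : Pattern n d} {y} → y ∈ L → y ∈ M → (∀ j → Parallel δ (L j) (M j)) → ∀ z → z ∈ L → z ∈ M
parallel-⊆ {δ = δ} {L} {M} {y} (s , es) (t , et) par z (r , er) = δ · r , λ j → go (L j) (M j) (par j) (es j) (et j) (er j)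
  where
  go : ∀ {j} k l → Parallel δ k l → lookup y j ≡ ev k s → lookup y j ≡ ev l t → lookup z j ≡ ev k r → lookup z j ≡ ev l (δ · r)
  go _ _ both-constant    e₁ e₂ e₃ = trans e₃ (trans (sym e₁) e₂)
  go _ _ (both-running h) e₁ e₂ e₃ = trans e₃ (h r)

sign-solve : ∀ u v δ {a b : Fin n} → a ≢ opposite a → b ≡ δ · a → u · a ≡ v · b → ∀ (r : Fin n) → u · r ≡ v · δ · r
sign-solve u v δ {a} a≢ b≡ e r =
  trans (cong (_· r) (sign-unique u (v xor δ) a≢ (trans e (trans (cong (v ·_) b≡) (·-xor v δ a))))) (sym (·-xor v δ r))

-- `turn` gives the sign with which a coordinate may run through p at parameter c. For odd n the
-- coordinate of p is the middle, every sign b is possible, and `turn j b` is b. For even n only one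
-- sign is possible, and `turn j` is used as a constant function.
module CentralLines (n≥3 : 3 ≤ n) (f : LineAut n d) (p : Point n d) (p-central : Central p)
  (c : Fin n) (turn : Fin d → Bool → Bool) (turn-c : ∀ j b → lookup p j ≡ turn j b · c) (j₀ : Fin d)
  (parity : (∀ j b → turn j b ≡ b) ⊎ (∀ (a : Fin n) → a ≢ opposite a)) where
  open LineAut f

  c-candidate : Candidate c
  c-candidate = candidate-same (same-sym (turn j₀ false , turn-c j₀ false)) (candidates p-central j₀)

  -- A test parameter: the point of `φ M` at t differs from p exactly in the running coordinates.
  t : Fin n
  t = proj₁ (outside-class n≥3 c)

  t≁c : ¬ Same t c
  t≁c = proj₂ (outside-class n≥3 c)

  t≢c : t ≢ c
  t≢c e = t≁c (false , e)

  shift : Fin d → Fin n ⊎ Bool → Fin n ⊎ Bool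
  shift j (inj₁ _) = inj₁ (lookup p j)
  shift j (inj₂ b) = inj₂ (turn j b)

  -- Lines through `to p` are moved to lines through p with the same running coordinates.
  φ : Pattern n d → Pattern n d
  φ M j = shift j (M j)

  φ-active : ∀ {M} → Active M → Active (φ M)
  φ-active (j , v , e) = j , turn j v , cong (shift j) e

  φ-∋p : ∀ M → p ∈ φ M
  φ-∋p M = c , λ j → go j (M j)
    where
    go : ∀ j k → lookup p j ≡ ev (shift j k) c
    go j (inj₁ _) = refl
    go j (inj₂ b) = turn-c j b

  -- A common test point of the shifted lines shows that M and N run in the same coordinates. Signs
  -- are compared at this point for odd n, and at the common point of M and N for even n, where no
  -- value is its own reflection.
  signs-agree : ∀ {M N t′ s s′} → (∀ j → ev (φ M j) t ≡ ev (φ N j) t′) →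
    (∀ j → ev (M j) s ≡ ev (N j) s′) → Active M → ∃ λ δ → ∀ j → Parallel δ (M j) (N j)
  signs-agree {M} {N} {t′} {s} {s′} et es (i , w , Mi) =
    let δ , par = at-i (M i) (N i) Mi (et i) (es i) in δ , λ j → par j (M j) (N j) (et j) (es j)
    where
    at-j : ∀ δ → t′ ≢ c → (∀ u v j → ev {n} (shift j (inj₂ u)) t ≡ ev (shift j (inj₂ v)) t′ → u · s ≡ v · s′ → ∀ (r : Fin n) → u · r ≡ v · δ · r) →
      ∀ j k l → ev (shift j k) t ≡ ev (shift j l) t′ → ev k s ≡ ev l s′ → Parallel δ k l
    at-j δ t′≢c run j (inj₁ a) (inj₁ b) _ _  = both-constant
    at-j δ t′≢c run j (inj₁ a) (inj₂ v) e _  =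
      ⊥-elim (t′≢c (·-injective (turn j v) (trans (sym e) (turn-c j v))))
    at-j δ t′≢c run j (inj₂ u) (inj₁ b) e _  =
      ⊥-elim (t≢c (·-injective (turn j u) (trans e (turn-c j u))))
    at-j δ t′≢c run j (inj₂ u) (inj₂ v) e e′ = both-running (run u v j e e′)

    at-i : ∀ k l → k ≡ inj₂ w → ev (shift i k) t ≡ ev (shift i l) t′ → ev k s ≡ ev l s′ →
      ∃ λ δ → ∀ j k l → ev (shift j k) t ≡ ev (shift j l) t′ → ev k s ≡ ev l s′ → Parallel δ k l
    at-i _ (inj₁ b) refl e e′ = ⊥-elim (t≢c (·-injective (turn i w) (trans e (turn-c i w))))
    at-i _ (inj₂ v) refl e e′ = v xor w , at-j (v xor w) t′≢c run
      where
      t′≢c : t′ ≢ c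
      t′≢c refl = t≁c (same-trans (same-sym (turn i w , refl)) (turn i v , e))
      run : ∀ u v′ j → turn j u · t ≡ turn j v′ · t′ → u · s ≡ v′ · s′ → ∀ (r : Fin n) → u · r ≡ v′ · (v xor w) · r
      run u v′ j e₁ e₂ = by parity
        where
        by : (∀ j b → turn j b ≡ b) ⊎ (∀ (a : Fin n) → a ≢ opposite a) → ∀ (r : Fin n) → u · r ≡ v′ · (v xor w) · r
        by (inj₁ turn≡) = sign-solve u v′ (v xor w) (outside-moved c-candidate t≁c)
          (trans (sym (·-move v (trans (sym (cong (_· t) (turn≡ i w))) (trans e (cong (_· t′) (turn≡ i v)))))) (·-xor v w t))
          (trans (sym (cong (_· t) (turn≡ j u))) (trans e₁ (cong (_· t′) (turn≡ j v′))))
        by (inj₂ even)  = sign-solve u v′ (v xor w) (even s) (trans (sym (·-move v e′)) (·-xor v w s)) e₂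

  φ-reflects : ∀ {M N} → to p ∈ M → to p ∈ N → Active M → Line≈ (φ M) (φ N) → Line≈ M N
  φ-reflects {M} {N} yM@(s , es) yN@(s′ , es′) act (sub , _) =
    let t′ , et = sub (pt (φ M) t) (pt-∈ (φ M) t)
        δ , par = signs-agree {M} {N} (λ j → trans (sym (lookup-pt (φ M) t j)) (et j)) (λ j → trans (sym (es j)) (es′ j)) act
    in parallel-⊆ {L = M} {N} {to p} yM yN par , parallel-⊆ {L = N} {M} {to p} yN yM (λ j → parallel-sym (par j))

  Through-p : Set
  Through-p = Σ (Pattern n d) λ L → Active L × p ∈ L

  h : Through-p → Through-p
  h (L , act , _) = let M , act′ , _ = to-preserves L act in φ M , φ-active {M} act′ , φ-∋p M

  -- The image of a line through p passes through `to p`, and φ brings it back to p. This self-map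
  -- `h` of the lines through p is injective by `φ-reflects`, hence onto.
  lines-onto : ∀ L → Active L → p ∈ L → ∃ λ M → Active M × to p ∈ M × Line≈ L (φ M)
  lines-onto L act pL =
    let (K , actK , pK) , L≈ = finite-onto (λ L M → Line≈ (proj₁ L) (proj₁ M)) (pattern-code ∘ proj₁)
          (λ {L} {M} e → ≗⇒Line≈ (pattern-code-injective (proj₁ L) (proj₁ M) e)) h (λ {L} {M} → h-injective L M) (L , act , pL)
        M , actM , into , _ = to-preserves K actK
    in M , actM , into p pK , L≈
    where
    h-injective : ∀ L M → Line≈ (proj₁ (h L)) (proj₁ (h M)) → Line≈ (proj₁ L) (proj₁ M)
    h-injective (L , actL , pL) (M , actM , pM) eq =
      let L′ , actL′ , mapsL = to-preserves L actL
          M′ , actM′ , mapsM = to-preserves M actM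
          sub , sup = φ-reflects {L′} {M′} (proj₁ mapsL p pL) (proj₁ mapsM p pM) actL′ eq
      in maps-reflect to-injective L M L′ M′ mapsL mapsM sub , maps-reflect to-injective M L M′ L′ mapsM mapsL sup

  -- The line through p running everywhere with signs w is some `φ M`; as φ keeps the running
  -- coordinates, M runs everywhere too and passes through `to p`. The second equation, used for odd
  -- n, ties the signs of M to w.
  full-line : (w : Fin d → Bool) → (∀ j → lookup p j ≡ w j · c) →
    ∃ λ s → ∃ λ t′ → ∀ j → ∃ λ b → lookup (to p) j ≡ b · s × w j · t ≡ turn j b · t′
  full-line w pw =
    let M , act , (s , es) , (sub , _) = lines-onto L (j₀ , w j₀ , refl) (c , pw)
        t′ , et = sub (pt L t) (pt-∈ L t)
    in s , t′ , λ j → go j (M j) (es j) (trans (sym (lookup-pt L t j)) (et j))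
    where
    L : Pattern n d
    L j = inj₂ (w j)
    go : ∀ {s t′} j k → lookup (to p) j ≡ ev k s → w j · t ≡ ev (shift j k) t′ →
      ∃ λ b → lookup (to p) j ≡ b · s × w j · t ≡ turn j b · t′
    go j (inj₁ a) e e′ = ⊥-elim (t≢c (·-injective (w j) (trans e′ (pw j))))
    go j (inj₂ b) e e′ = b , e , e′

-- For even n, one line through `to p` running everywhere puts its coordinates in one class. For odd
-- n there is such a line for each choice of signs, which makes any two coordinates of `to p` both
-- equal and opposite, hence the middle.
central-image : 3 ≤ n → 2 ≤ d → (f : LineAut n d) → ∀ p → Central p → Central (LineAut.to f p)
central-image {n} {d@(suc _)} n≥3 d≥2 f p p-central@(central same cand) with any? (λ (a : Fin n) → a ≟ opposite a)
... | no ¬mid =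
  let s , _ , on = full-line (λ j → proj₁ (same j zero)) (λ j → proj₂ (same j zero))
  in central (λ i j → same-trans (proj₁ (on i) , proj₁ (proj₂ (on i))) (same-sym (proj₁ (on j) , proj₁ (proj₂ (on j)))))
     λ i b e → ⊥-elim (¬mid (b , e))
  where
  open CentralLines n≥3 f p p-central (lookup p zero) (λ j _ → proj₁ (same j zero)) (λ j _ → proj₂ (same j zero)) zero
    (inj₂ λ a e → ¬mid (a , e))
... | yes (m , m-mid) =
  central (λ i j → false , equal i j) λ i b e → let k , k≢i = another d≥2 i in
    trans (opposed k i k≢i) (cong opposite (equal k i))
  where
  p≡m : ∀ j v → lookup p j ≡ v · m
  p≡m j v = trans (fixed-unique (cand j m m-mid) m-mid) (sym (·-fixed v m-mid))
  open CentralLines n≥3 f p p-central m (λ _ b → b) p≡m zero (inj₁ λ _ _ → refl)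
  open LineAut f
  relate : ∀ w i j → lookup (to p) j ≡ (w j xor w i) · lookup (to p) i
  relate w i j =
    let s , t′ , on = full-line w (λ j → p≡m j (w j))
        b , yi , wi = on i
        b′ , yj , wj = on j
        t≢ = outside-moved c-candidate t≁c
        b′≡ : b′ · t′ ≡ ((w j xor w i) xor b) · t′
        b′≡ = trans (sym wj) (trans (cong (w j ·_) (sym (trans (cong (w i ·_) (sym wi)) (·-self (w i) t))))
                (trans (·-xor (w j) (w i) _) (·-xor (w j xor w i) b t′)))
        t′≢ : t′ ≢ opposite t′
        t′≢ e = t≢ (·-fixed⁻ (w i) (trans wi (trans (cong (b ·_) e) (trans (·-comm-opposite b t′) (cong opposite (sym wi))))))
    in trans yj (trans (cong (_· s) (sign-unique b′ ((w j xor w i) xor b) t′≢ b′≡)) (trans (sym (·-xor (w j xor w i) b s)) (cong ((w j xor w i) ·_) (sym yi))))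
  equal : ∀ i j → lookup (to p) i ≡ lookup (to p) j
  equal i j = relate (λ _ → false) j i
  opposed : ∀ i j → i ≢ j → lookup (to p) j ≡ opposite (lookup (to p) i)
  opposed i j i≢j = trans (relate w i j) (cong (_· lookup (to p) i) flipped)
    where
    w : Fin d → Bool
    w k with k ≟ j
    ... | yes _ = true
    ... | no  _ = false
    flipped : w j xor w i ≡ true
    flipped with j ≟ j | i ≟ j
    ... | no ¬e | _     = ⊥-elim (¬e refl)
    ... | yes _ | yes e = ⊥-elim (i≢j e)
    ... | yes _ | no _  = refl

-- Axis-parallel lines through central points

infix 4 _∼[_]_
record _∼[_]_ (x : Point n d) (i : Fin d) (y : Point n d) : Set where
  constructor mk∼
  field off : ∀ j → j ≢ i → lookup x j ≡ lookup y j
open _∼[_]_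

∼-refl : {x : Point n d} {i : Fin d} → x ∼[ i ] x
∼-refl = mk∼ λ _ _ → refl

∼-sym : {x y : Point n d} {i : Fin d} → x ∼[ i ] y → y ∼[ i ] x
∼-sym h = mk∼ λ j j≢i → sym (off h j j≢i)

∼-trans : {x y z : Point n d} {i : Fin d} → x ∼[ i ] y → y ∼[ i ] z → x ∼[ i ] z
∼-trans h k = mk∼ λ j j≢i → trans (off h j j≢i) (off k j j≢i)

∼-≡ : {x y : Point n d} {i : Fin d} → x ∼[ i ] y → lookup x i ≡ lookup y i → x ≡ y
∼-≡ {i = i} h e = lookup-ext go
  where
  go : ∀ j → _
  go j with j ≟ i
  ... | yes refl = e
  ... | no j≢i   = off h j j≢i

update-∼ : (x : Point n d) (i : Fin d) (t : Fin n) → x [ i ]≔ t ∼[ i ] x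
update-∼ x i t = mk∼ λ j j≢i → lookup∘update′ j≢i x t

infix 20 _at_is_
_at_is_ : Pattern n d → Fin d → Fin n ⊎ Bool → Pattern n d
L at i is k = updateAt L i (λ _ → k)

at-here : (L : Pattern n d) (i : Fin d) {k : Fin n ⊎ Bool} → (L at i is k) i ≡ k
at-here L i = updateAt-updates i L

at-there : (L : Pattern n d) (i : Fin d) {k : Fin n ⊎ Bool} → ∀ {j} → j ≢ i → (L at i is k) j ≡ L j
at-there L i {j = j} j≢i = updateAt-minimal j i L j≢i

∈-at : (L : Pattern n d) (i : Fin d) (k : Fin n ⊎ Bool) (x : Point n d) (t : Fin n) →
  lookup x i ≡ ev k t → (∀ j → j ≢ i → lookup x j ≡ ev (L j) t) → ∀ j → lookup x j ≡ ev ((L at i is k) j) t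
∈-at L i k x t here there j with j ≟ i
... | yes refl = trans here (cong (λ l → ev l t) (sym (at-here L i)))
... | no j≢i   = trans (there j j≢i) (cong (λ l → ev l t) (sym (at-there L i j≢i)))

axis : Point n d → Fin d → Pattern n d
axis p i = (λ j → inj₁ (lookup p j)) at i is inj₂ false

axis-active : (p : Point n d) (i : Fin d) → Active (axis p i)
axis-active p i = i , false , at-here _ i

∼⇒∈axis : {x p : Point n d} {i : Fin d} → x ∼[ i ] p → x ∈ axis p i
∼⇒∈axis {x = x} {p} {i} h = lookup x i , ∈-at _ i (inj₂ false) x (lookup x i) refl (off h)

∈axis⇒∼ : {x p : Point n d} {i : Fin d} → x ∈ axis p i → x ∼[ i ] p
∈axis⇒∼ (t , e) = mk∼ λ j j≢i → trans (e j) (cong (λ l → ev l t) (at-there _ _ j≢i))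

∼⇒Col : {x y : Point n d} {i : Fin d} → x ∼[ i ] y → Col x y
∼⇒Col {x = x} {y} {i} h = axis y i , axis-active y i , ∼⇒∈axis h , ∼⇒∈axis {x = y} ∼-refl

central-∼ : {p y : Point n d} {i : Fin d} → Central p → y ∼[ i ] p → ∀ j → Same (lookup y i) (lookup p j) → Central y
central-∼ {p = p} {y} {i} pc y∼p j s = central-resp near pc
  where
  near : ∀ k → Same (lookup y k) (lookup p k)
  near k with k ≟ i
  ... | yes refl = same-trans s (one-class pc j k)
  ... | no k≢i   = false , off y∼p k k≢i

noncentral-∼ : 2 ≤ d → {p y : Point n d} {i : Fin d} → Central p → y ∼[ i ] p → ¬ Same (lookup y i) (lookup p i) → ¬ Central y
noncentral-∼ d≥2 {p} {y} {i} pc y∼p ¬s yc =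
  let k , k≢i = another d≥2 i
  in ¬s (same-trans (one-class yc i k) (same-trans (false , off y∼p k k≢i) (one-class pc k i)))

-- Among the lines through a central point, this property singles out those that are not axis-parallel.
Twinned : Pattern n d → Set
Twinned {n} {d} L = ∃ λ (M : Pattern n d) → Active M × (∃ λ z → z ∈ M × ¬ z ∈ L) ×
  (∀ x → x ∈ L → ¬ Central x → ∃ λ y → ∃ λ y′ → y ≢ y′ × y ∈ M × y′ ∈ M × ¬ Central y × ¬ Central y′ × Col x y × Col x y′)

-- For r outside the class of p, the two witnesses for the axis point with i-th coordinate r must
-- have i-th coordinate r themselves: otherwise a witness lies on the axis, and then so does all of
-- M. Hence M is constant in i with value r. The reflection of r is a different value with the same
-- property.
axis-untwinned : 3 ≤ n → 2 ≤ d → {p : Point n d} (i : Fin d) → Central p → ¬ Twinned (axis p i)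
axis-untwinned {n} {d} n≥3 d≥2 {p} i pc (M , act , (z , zM , z∉L) , twin) =
  let r , r≁ = outside-class n≥3 (lookup p i)
      (y , y′ , y≢y′ , yM , y′M , yi , y′i) = both-at r r≁
      (w , _ , _ , wM , _ , wi , _) = both-at (opposite r) (λ s → r≁ (same-trans (true , sym (opposite-involutive r)) s))
  in outside-moved (candidates pc i) r≁
       (trans (sym yi) (trans (sym (line-constant {L = M} {y} {y′} {w} yM y′M y≢y′ wM i (trans yi (sym y′i)))) wi))
  where
  two-common : ∀ {y y′} → y ≢ y′ → y ∈ M → y′ ∈ M → y ∼[ i ] p → y′ ∼[ i ] p → ⊥
  two-common {y} {y′} y≢y′ yM y′M y∼ y′∼ =
    z∉L (line-unique {L = M} {axis p i} {y} {y′} yM y′M (∼⇒∈axis y∼) (∼⇒∈axis y′∼) y≢y′ z zM)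

  on-axis : ∀ {x y} → x ∼[ i ] p → ¬ Same (lookup x i) (lookup p i) → Col x y → lookup y i ≢ lookup x i → y ∼[ i ] p
  on-axis {x} {y} x∼ x≁ col yi≢ = mk∼ agree
    where
    agree : ∀ j → j ≢ i → lookup y j ≡ lookup p j
    agree j j≢i with lookup y j ≟ lookup x j
    ... | yes e = trans e (off x∼ j j≢i)
    ... | no ne = ⊥-elim (x≁ (same-trans (proj₁ (col-moved {x = x} {y} col {i} {j} (yi≢ ∘ sym) (ne ∘ sym)))
                  (same-trans (false , off x∼ j j≢i) (one-class pc j i))))

  -- A non-central axis point y has its i-th coordinate outside the class of p, so by `col-moved` no
  -- coordinate besides i changes from y to y′.
  crossing : ∀ {y y′} → y ≢ y′ → y ∈ M → y′ ∈ M → ¬ Central y → y ∼[ i ] p → lookup y i ≢ lookup y′ i → ⊥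
  crossing {y} {y′} y≢y′ yM y′M ¬yc y∼ yi≢ = two-common y≢y′ yM y′M y∼ (mk∼ λ j j≢i → trans (equal j j≢i) (off y∼ j j≢i))
    where
    equal : ∀ j → j ≢ i → lookup y′ j ≡ lookup y j
    equal j j≢i with lookup y′ j ≟ lookup y j
    ... | yes e = e
    ... | no ne = ⊥-elim (¬yc (central-∼ pc y∼ j (same-trans
            (proj₁ (col-moved {x = y} {y′} (M , act , yM , y′M) {i} {j} yi≢ (ne ∘ sym))) (false , off y∼ j j≢i))))

  both-at : ∀ r → ¬ Same r (lookup p i) →
    ∃ λ y → ∃ λ y′ → y ≢ y′ × y ∈ M × y′ ∈ M × lookup y i ≡ r × lookup y′ i ≡ r
  both-at r r≁ = go (twin x (∼⇒∈axis x∼) (noncentral-∼ d≥2 pc x∼ x≁))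
    where
    x = p [ i ]≔ r
    x∼ : x ∼[ i ] p
    x∼ = update-∼ p i r
    xi : lookup x i ≡ r
    xi = lookup∘update i p r
    x≁ : ¬ Same (lookup x i) (lookup p i)
    x≁ s = r≁ (subst (λ a → Same a (lookup p i)) xi s)
    go : (∃ λ y → ∃ λ y′ → y ≢ y′ × y ∈ M × y′ ∈ M × ¬ Central y × ¬ Central y′ × Col x y × Col x y′) →
      ∃ λ y → ∃ λ y′ → y ≢ y′ × y ∈ M × y′ ∈ M × lookup y i ≡ r × lookup y′ i ≡ r
    go (y , y′ , y≢y′ , yM , y′M , ¬yc , ¬y′c , col , col′) with lookup y i ≟ lookup x i | lookup y′ i ≟ lookup x i
    ... | yes e | yes e′ = y , y′ , y≢y′ , yM , y′M , trans e xi , trans e′ xi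
    ... | no ne | no ne′ = ⊥-elim (two-common y≢y′ yM y′M (on-axis x∼ x≁ col ne) (on-axis x∼ x≁ col′ ne′))
    ... | no ne | yes e′ = ⊥-elim (crossing y≢y′ yM y′M ¬yc (on-axis x∼ x≁ col ne) (λ e → ne (trans e e′)))
    ... | yes e | no ne′ = ⊥-elim (crossing (y≢y′ ∘ sym) y′M yM ¬y′c (on-axis x∼ x≁ col′ ne′) (λ e′ → ne′ (trans e′ e)))

-- M reverses the sign of one running coordinate i. The point of L at r is joined to the point of M
-- at r along the axis i, and to the point of M at the reflection of r along L with coordinate i
-- frozen; j still runs on the latter.
skew-twinned : 3 ≤ n → (L : Pattern n d) {p : Point n d} → Central p → p ∈ L →
  ∀ {i j u v} → i ≢ j → L i ≡ inj₂ u → L j ≡ inj₂ v → Twinned L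
skew-twinned {n} {d} n≥3 L {p} pc (s , es) {i} {j} {u} {v} i≢j Li Lj =
  M , (i , not u , at-here L i) , (pt M t₀ , pt-∈ M t₀ , z∉L) , twin
  where
  M : Pattern n d
  M = L at i is inj₂ (not u)
  t₀ = proj₁ (zero-moved n≥3)
  evᵢ : ∀ t → ev (L i) t ≡ u · t
  evᵢ t = cong (λ l → ev l t) Li
  evⱼ : ∀ t → ev (L j) t ≡ v · t
  evⱼ t = cong (λ l → ev l t) Lj
  ptᵢ : ∀ t → lookup (pt M t) i ≡ not u · t
  ptᵢ t = trans (lookup-pt M t i) (cong (λ l → ev l t) (at-here L i))
  ptₖ : ∀ t k → k ≢ i → lookup (pt M t) k ≡ ev (L k) t
  ptₖ t k k≢i = trans (lookup-pt M t k) (cong (λ l → ev l t) (at-there L i k≢i))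
  not-· : ∀ b (t : Fin n) → not b · t ≡ b · opposite t
  not-· false t = refl
  not-· true  t = sym (opposite-involutive t)
  z∉L : ¬ pt M t₀ ∈ L
  z∉L (t , e) = proj₂ (zero-moved n≥3) (trans t₀≡t (sym (·-injective u
    (trans (sym (not-· u t₀)) (trans (sym (ptᵢ t₀)) (trans (e i) (evᵢ t)))))))
    where
    t₀≡t : t₀ ≡ t
    t₀≡t = ·-injective v (trans (sym (evⱼ t₀)) (trans (sym (ptₖ t₀ j (i≢j ∘ sym))) (trans (e j) (evⱼ t))))

  twin : ∀ x → x ∈ L → ¬ Central x →
    ∃ λ y → ∃ λ y′ → y ≢ y′ × y ∈ M × y′ ∈ M × ¬ Central y × ¬ Central y′ × Col x y × Col x y′
  twin x (r , er) ¬xc = y , y′ , y≢y′ , pt-∈ M r , pt-∈ M r̄ ,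
    (λ yc → ¬xc (central-resp (near r same-refl) yc)) , (λ yc → ¬xc (central-resp (near r̄ (true , sym (opposite-involutive r))) yc)) ,
    ∼⇒Col {x = x} {y} (mk∼ λ k k≢i → trans (er k) (sym (ptₖ r k k≢i))) ,
    (L at i is inj₁ (lookup x i) , (j , v , trans (at-there L i (i≢j ∘ sym)) Lj) ,
      (r , ∈-at L i _ x r refl (λ k _ → er k)) ,
      (r̄ , ∈-at L i _ y′ r̄ (trans (ptᵢ r̄) (trans (not-· u r̄) (trans (cong (u ·_) (opposite-involutive r)) (sym (trans (er i) (evᵢ r)))))) (ptₖ r̄)))
    where
    r̄ = opposite r
    y = pt M r
    y′ = pt M r̄
    r-moved : r ≢ r̄
    -- If r were fixed, so would be the parameter s of p; then s = r and x is the central point p.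
    r-moved e = ¬xc (subst Central (lookup-ext λ k → trans (es k) (trans (cong (ev (L k)) s≡r) (sym (er k)))) pc)
      where
      s≡r : s ≡ r
      s≡r = fixed-unique (candidate-same (same-sym (u , trans (es i) (evᵢ s))) (candidates pc i) r e) e
    y≢y′ : y ≢ y′
    y≢y′ e = r-moved (·-injective v (trans (sym (trans (ptₖ r j (i≢j ∘ sym)) (evⱼ r)))
      (trans (cong (λ a → lookup a j) e) (trans (ptₖ r̄ j (i≢j ∘ sym)) (evⱼ r̄)))))
    ev-same : ∀ k {a b : Fin n} → Same a b → Same (ev k a) (ev k b)
    ev-same (inj₁ _) _ = same-refl
    ev-same (inj₂ w) s = same-trans (same-· w) (same-trans s (same-sym (same-· w)))
    near : ∀ t → Same r t → ∀ k → Same (lookup x k) (lookup (pt M t) k)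
    near t r~t k with k ≟ i
    ... | yes refl = same-trans (u , trans (er k) (evᵢ r)) (same-trans r~t (same-sym (not u , ptᵢ t)))
    ... | no k≢i   = subst₂ Same (sym (er k)) (sym (ptₖ t k k≢i)) (ev-same (L k) r~t)

-- `Twinned` speaks of incidence and centrality only, and both are preserved by f and its inverse.
twinned-transfer : 3 ≤ n → 2 ≤ d → (f : LineAut n d) → ∀ L M → Active L → Maps (LineAut.to f) L M → Twinned M → Twinned L
twinned-transfer n≥3 d≥2 f L M act (into , onto) (K , actK , (z , zK , z∉M) , twin) =
  let K′ , actK′ , K-into , _ = from-preserves K actK
  in K′ , actK′ , (from z , K-into z zK , λ gz∈L → z∉M (subst (_∈ M) (to-from z) (into _ gz∈L))) ,
     λ x xL ¬xc →
       let y , y′ , y≢y′ , yK , y′K , ¬yc , ¬y′c , col , col′ =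
             twin (to x) (into x xL) (λ c → ¬xc (subst Central (from-to x) (central-image n≥3 d≥2 (inverse f) _ c)))
       in from y , from y′ , (λ e → y≢y′ (LineAut.to-injective (inverse f) e)) , K-into y yK , K-into y′ y′K ,
          (λ c → ¬yc (subst Central (to-from y) (central-image n≥3 d≥2 f _ c))) ,
          (λ c → ¬y′c (subst Central (to-from y′) (central-image n≥3 d≥2 f _ c))) ,
          subst (λ a → Col a (from y)) (from-to x) (LineAut.to-col (inverse f) col) ,
          subst (λ a → Col a (from y′)) (from-to x) (LineAut.to-col (inverse f) col′)
  where open LineAut f

-- A second running coordinate would make the image line twinned, and with it the axis.
axis-image : 3 ≤ n → 2 ≤ d → (f : LineAut n d) → ∀ {p} → Central p → ∀ i →
  ∃ λ j → ∀ x → x ∼[ i ] p → LineAut.to f x ∼[ j ] LineAut.to f p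
axis-image {n} {d} n≥3 d≥2 f {p} pc i =
  let M , (j , v , Mj) , maps = to-preserves (axis p i) (axis-active p i)
  in j , λ x x∼ → mk∼ λ k k≢j → go M j v Mj maps k k≢j (M k) refl (to x) (to p) (proj₁ maps x (∼⇒∈axis x∼)) (proj₁ maps p p∈axis)
  where
  open LineAut f
  p∈axis : p ∈ axis p i
  p∈axis = ∼⇒∈axis {x = p} ∼-refl
  go : ∀ M j v → M j ≡ inj₂ v → Maps to (axis p i) M → ∀ k → k ≢ j → ∀ l → M k ≡ l →
    ∀ x y → x ∈ M → y ∈ M → lookup x k ≡ lookup y k
  go M j v Mj maps k k≢j (inj₁ a) Mk x y (s , es) (t , et) =
    trans (es k) (trans (cong (λ l → ev l s) Mk) (trans (sym (cong (λ l → ev l t) Mk)) (sym (et k))))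
  go M j v Mj maps k k≢j (inj₂ w) Mk _ _ _ _ =
    ⊥-elim (axis-untwinned n≥3 d≥2 i pc (twinned-transfer n≥3 d≥2 f (axis p i) M (axis-active p i) maps
      (skew-twinned n≥3 M (central-image n≥3 d≥2 f p pc) (proj₁ maps p p∈axis) k≢j Mk Mj)))

-- Images of diagonal points

corner-central : {p : Point n d} {c : Fin n} → Candidate c → (∀ j → Same (lookup p j) c) → Central p
corner-central cand s = central (λ i j → same-trans (s i) (same-sym (s j))) λ i → candidate-same (s i) cand

noncentral-image : 3 ≤ n → 2 ≤ d → (f : LineAut n d) → ∀ {x} → ¬ Central x → ¬ Central (LineAut.to f x)
noncentral-image n≥3 d≥2 f {x} ¬xc c =
  ¬xc (subst Central (LineAut.from-to f x) (central-image n≥3 d≥2 (inverse f) _ c))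

update-≡ : (x : Point n d) (i : Fin d) {y : Point n d} → y ∼[ i ] x → y ≡ x [ i ]≔ lookup y i
update-≡ x i {y} y∼x = ∼-≡ (∼-trans y∼x (∼-sym (update-∼ x i (lookup y i)))) (sym (lookup∘update i x (lookup y i)))

-- The image of a diagonal point x is read off the images of its projections to the axes
-- through the corner p: x is collinear with each projection, and being collinear with the images
-- of all projections leaves no other choice.
star : 3 ≤ n → 2 ≤ d → (f : LineAut n d) → let open LineAut f in
  {p x : Point n d} {c s : Fin n} (v : Fin d → Bool) → Candidate c → ¬ Same s c →
  (∀ j → lookup p j ≡ v j · c) → (∀ j → lookup x j ≡ v j · s) →
  (τ : Fin d → Fin d) → (∀ {i k} → τ i ≡ τ k → i ≡ k) → (∀ i y → y ∼[ i ] p → to y ∼[ τ i ] to p) →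
  ∀ i → lookup (to x) (τ i) ≡ lookup (to (p [ i ]≔ lookup x i)) (τ i)
star {n} {d} n≥3 d≥2 f {p} {x} {c} {s} v cand s≁c pv xv τ τ-inj axes i with lookup (to x) (τ i) ≟ lookup (to (p [ i ]≔ lookup x i)) (τ i)
  where open LineAut f
... | yes e = e
... | no ne = ⊥-elim (s≁c (false , ·-injective (v i) (trans (sym (xv i)) (trans (cong (λ z → lookup z i) x≡p) (pv i)))))
  where
  open LineAut f
  pc : Central p
  pc = corner-central cand λ j → v j , pv j
  y : Fin d → Point n d
  y i = p [ i ]≔ lookup x i
  yi : ∀ i → lookup (y i) i ≡ lookup x i
  yi i = lookup∘update i p (lookup x i)
  y∼ : ∀ i → y i ∼[ i ] p
  y∼ i = update-∼ p i (lookup x i)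
  col : ∀ i → Col x (y i)
  col i = L , active , (s , ∈-at _ i _ x s refl (λ j _ → xv j)) ,
          (c , ∈-at _ i _ (y i) c (yi i) (λ j j≢i → trans (off (y∼ i) j j≢i) (pv j)))
    where
    L : Pattern n d
    L = (λ j → inj₂ (v j)) at i is inj₁ (lookup x i)
    active : Active L
    active = let k , k≢i = another d≥2 i in k , v k , at-there _ i k≢i
  y-noncentral : ∀ i → ¬ Central (y i)
  y-noncentral i = noncentral-∼ d≥2 pc (y∼ i) λ sm → s≁c (same-trans (same-sym (v i , trans (yi i) (xv i)))
                     (same-trans sm (v i , pv i)))
  toy≁ : ∀ i j → ¬ Same (lookup (to (y i)) (τ i)) (lookup (to p) j)
  toy≁ i j sm = noncentral-image n≥3 d≥2 f (y-noncentral i)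
    (central-∼ (central-image n≥3 d≥2 f p pc) (axes i (y i) (y∼ i)) j sm)
  on-axis : ∀ i → lookup (to x) (τ i) ≢ lookup (to (y i)) (τ i) → to x ∼[ τ i ] to p
  on-axis i ne = mk∼ agree
    where
    agree : ∀ j → j ≢ τ i → lookup (to x) j ≡ lookup (to p) j
    agree j j≢ with lookup (to x) j ≟ lookup (to (y i)) j
    ... | yes e = trans e (off (axes i (y i) (y∼ i)) j j≢)
    ... | no ne′ = ⊥-elim (toy≁ i j (same-trans (proj₂ (col-moved {x = to x} {to (y i)} (to-col (col i)) {τ i} {j} ne ne′))
                     (false , off (axes i (y i) (y∼ i)) j j≢)))
  -- With a wrong value at `τ i`, `to x` lies on the axis `τ i` through `to p`. Then its value at
  -- `τ k` is wrong as well, so it lies on a second axis, and the two meet only in `to p`.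
  x≡p : x ≡ p
  x≡p =
    let k , k≢i = another d≥2 i
        k-bad : lookup (to x) (τ k) ≢ lookup (to (y k)) (τ k)
        k-bad e = toy≁ k (τ k) (false , trans (sym e) (off (on-axis i ne) (τ k) (k≢i ∘ τ-inj)))
    in to-injective (∼-≡ (on-axis i ne) (off (on-axis k k-bad) (τ i) (k≢i ∘ sym ∘ τ-inj)))

-- Points with all coordinates in a single class

module Normalised (n≥3 : 3 ≤ n) (d≥2 : 2 ≤ d) (f : LineAut n d) (i₀ : Fin d) (c : Fin n) (cand : Candidate c)
  (ρ : Fin n → Fin n) (constants : ∀ t → LineAut.to f (replicate d t) ≡ replicate d (ρ t))
  (axes : ∀ i y → y ∼[ i ] replicate d c → LineAut.to f y ∼[ i ] LineAut.to f (replicate d c)) where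
  open LineAut f

  p₀ : Point n d
  p₀ = replicate d c

  p₀-central : Central p₀
  p₀-central = corner-central cand λ j → false , lookup-replicate j c

  to-p₀ : ∀ j → lookup (to p₀) j ≡ ρ c
  to-p₀ j = trans (cong (λ x → lookup x j) (constants c)) (lookup-replicate j (ρ c))

  ρ-injective : ∀ {s t} → ρ s ≡ ρ t → s ≡ t
  ρ-injective {s} {t} e = trans (sym (lookup-replicate i₀ s)) (trans (cong (λ x → lookup x i₀)
    (to-injective (trans (constants s) (trans (cong (replicate d) e) (sym (constants t)))))) (lookup-replicate i₀ t))

  -- By `star` with trivial signs, the axis point shares the i-th coordinate of its image with the
  -- diagonal point (t, ..., t).
  axis-value : ∀ i {t} → ¬ Same t c → lookup (to (p₀ [ i ]≔ t)) i ≡ ρ t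
  axis-value i {t} t≁c = trans (cong (λ a → lookup (to (p₀ [ i ]≔ a)) i) (sym (lookup-replicate i t)))
    (trans (sym (star n≥3 d≥2 f (λ _ → false) cand t≁c (λ j → lookup-replicate j c) (λ j → lookup-replicate j t) id id axes i))
    (trans (cong (λ x → lookup x i) (constants t)) (lookup-replicate i (ρ t))))

  ρ-apart : ∀ {t} → ¬ Same t c → ¬ Same (ρ t) (ρ c)
  ρ-apart {t} t≁c s = noncentral-image n≥3 d≥2 f y-noncentral
    (central-∼ (central-image n≥3 d≥2 f p₀ p₀-central) (axes i₀ y y∼) i₀
      (subst₂ Same (sym (axis-value i₀ t≁c)) (sym (to-p₀ i₀)) s))
    where
    y = p₀ [ i₀ ]≔ t
    y∼ : y ∼[ i₀ ] p₀
    y∼ = update-∼ p₀ i₀ t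
    y-noncentral : ¬ Central y
    y-noncentral = noncentral-∼ d≥2 p₀-central y∼ λ s →
      t≁c (subst₂ Same (lookup∘update i₀ p₀ t) (lookup-replicate i₀ c) s)

  -- By `ρ-apart` the preimage of the reflection of ρ c lies in the class of c. If it is c, then ρ c
  -- is fixed by reflection, and so is the candidate c.
  ρ-opposite-c : ρ (opposite c) ≡ opposite (ρ c)
  ρ-opposite-c with injective⇒onto ρ ρ-injective (opposite (ρ c))
  ... | b , e with same? b c
  ...   | no b≁c            = ⊥-elim (ρ-apart b≁c (true , sym e))
  ...   | yes (true , refl) = sym e
  ...   | yes (false , refl) = trans (cong ρ (sym (cand (ρ c) (sym e)))) (sym e)

  ρ-opposite : ∀ {a} → Same a c → ρ (opposite a) ≡ opposite (ρ a)
  ρ-opposite (false , refl) = ρ-opposite-c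
  ρ-opposite (true , refl)  = trans (cong ρ (opposite-involutive c))
    (trans (sym (opposite-involutive (ρ c))) (cong opposite (sym ρ-opposite-c)))

  ρ-same : ∀ {a} → Same a c → Same (ρ a) (ρ c)
  ρ-same (false , refl) = same-refl
  ρ-same (true , refl)  = true , ρ-opposite-c

  map-∼ : ∀ {i} {x y : Point n d} → x ∼[ i ] y → map ρ x ∼[ i ] map ρ y
  map-∼ {x = x} {y} h = mk∼ λ j j≢i → trans (lookup-map j ρ x) (trans (cong ρ (off h j j≢i)) (sym (lookup-map j ρ y)))

  Corner : Point n d → Set
  Corner p = ∀ j → Same (lookup p j) c

  -- Agreement on whole axes is what `step` starts from: the next corner and the points used for
  -- comparison all lie on axes through p.
  Good : Point n d → Set
  Good p = ∀ i y → y ∼[ i ] p → to y ≡ map ρ y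

  -- The image of y is central, so on the axis i through `to p` it is either `to p` or the point
  -- with the opposite coordinate; injectivity excludes the former.
  opposite-corner : ∀ {p y i} → Corner p → to p ≡ map ρ p → y ∼[ i ] p → to y ∼[ i ] to p →
    lookup y i ≡ opposite (lookup p i) → y ≢ p → to y ≡ map ρ y
  opposite-corner {p} {y} {i} p-corner to-p y∼p ty∼tp yi y≢p =
    ∼-≡ (∼-trans ty∼tp (subst (_∼[ i ] map ρ y) (sym to-p) (∼-sym (map-∼ y∼p)))) value
    where
    y-corner : Corner y
    y-corner j with j ≟ i
    ... | yes refl = subst (λ a → Same a c) (sym yi) (same-trans (true , refl) (p-corner i))
    ... | no j≢i   = subst (λ a → Same a c) (sym (off y∼p j j≢i)) (p-corner j)
    ty-central : Central (to y)
    ty-central = central-image n≥3 d≥2 f y (corner-central cand y-corner)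
    tp : ∀ j → lookup (to p) j ≡ ρ (lookup p j)
    tp j = trans (cong (λ x → lookup x j) to-p) (lookup-map j ρ p)
    near : Same (lookup (to y) i) (lookup (to p) i)
    near = let k , k≢i = another d≥2 i in same-trans (one-class ty-central i k)
      (same-trans (false , off ty∼tp k k≢i) (one-class (central-image n≥3 d≥2 f p (corner-central cand p-corner)) k i))
    value : lookup (to y) i ≡ lookup (map ρ y) i
    value = trans (same-≢ near (λ e → y≢p (to-injective (∼-≡ ty∼tp e))))
      (trans (cong opposite (tp i)) (trans (sym (ρ-opposite (p-corner i))) (trans (cong ρ (sym yi)) (sym (lookup-map i ρ y)))))

  p₀-fixed : to p₀ ≡ map ρ p₀
  p₀-fixed = lookup-ext λ j → trans (to-p₀ j) (sym (trans (lookup-map j ρ p₀) (cong ρ (lookup-replicate j c))))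

  p₀-good : Good p₀
  p₀-good i y y∼ with same? (lookup y i) c
  ... | no ≁ = ∼-≡ (∼-trans (axes i y y∼) (subst (_∼[ i ] map ρ y) (sym p₀-fixed) (∼-sym (map-∼ y∼))))
        (trans (cong (λ z → lookup (to z) i) (update-≡ p₀ i y∼)) (trans (axis-value i ≁) (sym (lookup-map i ρ y))))
  ... | yes s with lookup y i ≟ lookup p₀ i
  ...   | yes e = subst (λ z → to z ≡ map ρ z) (sym (∼-≡ y∼ e)) p₀-fixed
  ...   | no ne = opposite-corner (λ j → false , lookup-replicate j c) p₀-fixed y∼ (axes i y y∼)
          (same-≢ (same-trans s (false , sym (lookup-replicate i c))) ne) (λ e → ne (cong (λ z → lookup z i) e))

  -- For i ≠ k, a point y on the axis i of the new corner, outside the class of c, is compared with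
  -- the point w of the axis i through p that differs from y only in k.
  step : ∀ p → Corner p → Good p → ∀ k a → Same a c → Good (p [ k ]≔ a)
  step p p-corner good k a a~c i y y∼q with lookup p k ≟ a
  ... | yes e = good i y (subst (y ∼[ i ]_) (sym (∼-≡ (∼-sym (update-∼ p k a)) (trans e (sym (lookup∘update k p a))))) y∼q)
  ... | no pk≢a with i ≟ k
  ...   | yes refl = good k y (∼-trans y∼q (update-∼ p k a))
  ...   | no i≢k = on-axis
    where
    q = p [ k ]≔ a
    q∼p : q ∼[ k ] p
    q∼p = update-∼ p k a
    qk : lookup q k ≡ a
    qk = lookup∘update k p a
    to-q : to q ≡ map ρ q
    to-q = good k q q∼p
    tq : ∀ j → lookup (to q) j ≡ ρ (lookup q j)
    tq j = trans (cong (λ x → lookup x j) to-q) (lookup-map j ρ q)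
    q-corner : Corner q
    q-corner j with j ≟ k
    ... | yes refl = subst (λ b → Same b c) (sym qk) a~c
    ... | no j≢k   = subst (λ b → Same b c) (sym (off q∼p j j≢k)) (p-corner j)
    direction = axis-image n≥3 d≥2 f (corner-central cand q-corner) i
    i′ = proj₁ direction

    -- `to y` is collinear with `to w` and lies on the axis i′ through `to q`. Suppose its i-th
    -- coordinate is wrong. A difference from `to w` at k too contradicts `ρ-apart`; agreement at k
    -- forces `lookup p k` = a if k ≠ i′, and y = p if k = i′.
    outer : ∀ y → y ∼[ i ] q → ¬ Same (lookup y i) c → i ≡ i′ × lookup (to y) i ≡ ρ (lookup y i)
    outer y y∼q yi≁c = i≡i′ , value
      where
      s = lookup y i
      w = p [ i ]≔ s
      wi : lookup w i ≡ s
      wi = lookup∘update i p s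
      wk : lookup w k ≡ lookup p k
      wk = off (update-∼ p i s) k (i≢k ∘ sym)
      y∼w : y ∼[ k ] w
      y∼w = mk∼ agree
        where
        agree : ∀ j → j ≢ k → lookup y j ≡ lookup w j
        agree j j≢k with j ≟ i
        ... | yes refl = sym wi
        ... | no j≢i   = trans (off y∼q j j≢i) (trans (off q∼p j j≢k) (sym (off (update-∼ p i s) j j≢i)))
      to-w : to w ≡ map ρ w
      to-w = good i w (update-∼ p i s)
      twi : lookup (to w) i ≡ ρ s
      twi = trans (cong (λ x → lookup x i) to-w) (trans (lookup-map i ρ w) (cong ρ wi))
      twk : lookup (to w) k ≡ ρ (lookup p k)
      twk = trans (cong (λ x → lookup x k) to-w) (trans (lookup-map k ρ w) (cong ρ wk))
      col : Col (to y) (to w)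
      col = to-col (∼⇒Col {x = y} {w} y∼w)
      value : lookup (to y) i ≡ ρ s
      value with lookup (to y) i ≟ lookup (to w) i
      ... | yes e = trans e twi
      ... | no ne with lookup (to y) k ≟ lookup (to w) k
      ...   | no ne′ = ⊥-elim (ρ-apart yi≁c (same-trans
                (subst₂ Same twi twk (proj₂ (col-moved {x = to y} {to w} col {i} {k} ne ne′))) (ρ-same (p-corner k))))
      ...   | yes e with k ≟ i′
      ...     | no k≢i′ = ⊥-elim (pk≢a (ρ-injective (trans (sym twk) (trans (sym e)
                  (trans (off (proj₂ direction y y∼q) k k≢i′) (trans (tq k) (cong ρ qk)))))))
      ...     | yes k≡i′ = ⊥-elim (pk≢a (trans (cong (λ x → lookup x k) (sym y≡p))
                  (trans (off y∼q k (i≢k ∘ sym)) qk)))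
        where
        to-p : to p ≡ map ρ p
        to-p = good k p ∼-refl
        y≡p : y ≡ p
        y≡p = to-injective (∼-≡ (∼-trans (subst (λ j → to y ∼[ j ] to q) (sym k≡i′) (proj₂ direction y y∼q))
                (subst₂ (_∼[ k ]_) (sym to-q) (sym to-p) (map-∼ q∼p)))
                (trans e (trans twk (sym (trans (cong (λ x → lookup x k) to-p) (lookup-map k ρ p))))))
      i≡i′ : i ≡ i′
      i≡i′ with i ≟ i′
      ... | yes e = e
      ... | no ne = ⊥-elim (yi≁c (subst (λ b → Same b c)
              (sym (ρ-injective (trans (sym value) (trans (off (proj₂ direction y y∼q) i ne) (tq i))))) (q-corner i)))

    same-axis : i ≡ i′
    same-axis = let s , s≁c = outside-class n≥3 c in
      proj₁ (outer (q [ i ]≔ s) (update-∼ q i s) (λ sm → s≁c (subst (λ b → Same b c) (lookup∘update i q s) sm)))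

    ty∼tq : to y ∼[ i ] to q
    ty∼tq = subst (λ j → to y ∼[ j ] to q) (sym same-axis) (proj₂ direction y y∼q)

    on-axis : to y ≡ map ρ y
    on-axis with same? (lookup y i) c
    ... | no ≁ = ∼-≡ (∼-trans ty∼tq (subst (_∼[ i ] map ρ y) (sym to-q) (∼-sym (map-∼ y∼q))))
          (trans (proj₂ (outer y y∼q ≁)) (sym (lookup-map i ρ y)))
    ... | yes s with lookup y i ≟ lookup q i
    ...   | yes e = subst (λ z → to z ≡ map ρ z) (sym (∼-≡ y∼q e)) to-q
    ...   | no ne = opposite-corner q-corner to-q y∼q ty∼tq
            (same-≢ (same-trans s (same-sym (q-corner i))) ne) (λ e → ne (cong (λ z → lookup z i) e))

  -- Only coordinates of index below m may differ from c; the last of them is reset to c and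
  -- restored by `step`.
  corners-good : ∀ m p → Corner p → (∀ j → m ≤ toℕ j → lookup p j ≡ c) → Good p
  corners-good zero    p _        tail = subst Good (lookup-ext λ j → trans (lookup-replicate j c) (sym (tail j z≤n))) p₀-good
  corners-good (suc m) p p-corner tail with m ℕ.<? d
  ... | no m≮d = corners-good m p p-corner λ j m≤j → ⊥-elim (m≮d (ℕ.≤-<-trans m≤j (toℕ<n j)))
  ... | yes m<d = subst Good (sym (update-≡ q k (∼-sym (update-∼ p k c)))) (step q q-corner q-good k (lookup p k) (p-corner k))
    where
    k = fromℕ< m<d
    q = p [ k ]≔ c
    q-corner : Corner q
    q-corner j with j ≟ k
    ... | yes refl = false , lookup∘update k p c
    ... | no j≢k   = subst (λ a → Same a c) (sym (lookup∘update′ j≢k p c)) (p-corner j)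
    q-good : Good q
    q-good = corners-good m q q-corner tail′
      where
      tail′ : ∀ j → m ≤ toℕ j → lookup q j ≡ c
      tail′ j m≤j with j ≟ k
      ... | yes refl = lookup∘update k p c
      ... | no j≢k   = trans (lookup∘update′ j≢k p c)
              (tail j (ℕ.≤∧≢⇒< m≤j λ e → j≢k (toℕ-injective (trans (sym e) (sym (toℕ-fromℕ< m<d))))))

  corner-good : ∀ p → Corner p → Good p
  corner-good p p-corner = corners-good d p p-corner λ j d≤j → ⊥-elim (ℕ.<⇒≱ (toℕ<n j) d≤j)

  OneClass : Point n d → Set
  OneClass x = ∀ i j → Same (lookup x i) (lookup x j)

  -- Outside the class of c, x is a signed diagonal point; the corner p with the same signs has axes
  -- on which f is known, and `star` then determines the image of x.
  one-class-image : ∀ x → OneClass x → to x ≡ map ρ x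
  one-class-image x one with same? (lookup x i₀) c
  ... | yes s = corner-good x (λ j → same-trans (one j i₀) s) i₀ x ∼-refl
  ... | no ≁ = lookup-ext λ i → trans
          (star n≥3 d≥2 f v cand ≁ pv (λ j → proj₂ (one j i₀)) id id p-axes i)
          (trans (cong (λ z → lookup z i) (p-good i _ (update-∼ p i (lookup x i))))
          (trans (lookup-map i ρ (p [ i ]≔ lookup x i)) (trans (cong ρ (lookup∘update i p (lookup x i))) (sym (lookup-map i ρ x)))))
    where
    v = λ j → proj₁ (one j i₀)
    p = tabulate λ j → v j · c
    pv : ∀ j → lookup p j ≡ v j · c
    pv = lookup∘tabulate λ j → v j · c
    p-good : Good p
    p-good = corner-good p λ j → v j , pv j
    p-axes : ∀ i y → y ∼[ i ] p → to y ∼[ i ] to p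
    p-axes i y y∼p = subst₂ (_∼[ i ]_) (sym (p-good i y y∼p)) (sym (p-good i p ∼-refl)) (map-∼ y∼p)

  -- The image of the diagonal (n-1-t, t, …, t) is a line.
  ρ-symmetric : ∀ t → ρ (opposite t) ≡ opposite (ρ t)
  ρ-symmetric with another d≥2 i₀
  ... | k , k≢i₀ = go (M i₀) (M k) (λ t → proj₁ (proj₂ (coordinates t))) (λ t → proj₂ (proj₂ (coordinates t)))
    where
    L : Pattern n d
    L = (λ _ → inj₂ false) at i₀ is inj₂ true
    M = proj₁ (to-preserves L (i₀ , true , at-here _ i₀))
    t₀ = proj₁ (zero-moved n≥3)
    one : ∀ t → OneClass (pt L t)
    one t i j = same-trans (near i) (same-sym (near j))
      where
      near : ∀ i → Same (lookup (pt L t) i) t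
      near i with i ≟ i₀
      ... | yes refl = true , trans (lookup-pt L t i) (cong (λ l → ev l t) (at-here _ i))
      ... | no i≢    = false , trans (lookup-pt L t i) (cong (λ l → ev l t) (at-there _ i₀ i≢))
    coordinates : ∀ t → ∃ λ s → ρ (opposite t) ≡ ev (M i₀) s × ρ t ≡ ev (M k) s
    coordinates t =
      let s , e = proj₁ (proj₂ (proj₂ (to-preserves L (i₀ , true , at-here _ i₀)))) (pt L t) (pt-∈ L t)
          image = λ j → trans (cong (λ x → lookup x j) (one-class-image (pt L t) (one t))) (lookup-map j ρ (pt L t))
      in s , trans (cong ρ (sym (trans (lookup-pt L t i₀) (cong (λ l → ev l t) (at-here _ i₀))))) (trans (sym (image i₀)) (e i₀)) ,
             trans (cong ρ (sym (trans (lookup-pt L t k) (cong (λ l → ev l t) (at-there _ i₀ k≢i₀))))) (trans (sym (image k)) (e k))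
    go : ∀ l l′ {s : Fin n → Fin n} → (∀ t → ρ (opposite t) ≡ ev l (s t)) → (∀ t → ρ t ≡ ev l′ (s t)) →
      ∀ t → ρ (opposite t) ≡ opposite (ρ t)
    go (inj₁ a) l′ h h′ t = ⊥-elim (proj₂ (zero-moved n≥3) (ρ-injective
      (trans (cong ρ (sym (opposite-involutive t₀))) (trans (h (opposite t₀)) (trans (sym (h t₀)) refl)))))
    go (inj₂ u) (inj₁ a) h h′ t = ⊥-elim (proj₂ (zero-moved n≥3) (ρ-injective (trans (h′ t₀) (sym (h′ (opposite t₀))))))
    go (inj₂ u) (inj₂ w) {s} h h′ t = trans (relate t) (cong (_· ρ t) turned)
      where
      relate : ∀ t → ρ (opposite t) ≡ (u xor w) · ρ t
      relate t = trans (h t) (trans (cong (u ·_) (sym (·-move w (h′ t)))) (·-xor u w (ρ t)))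
      turned : u xor w ≡ true
      turned with u xor w | relate t₀
      ... | true  | _ = refl
      ... | false | e = ⊥-elim (proj₂ (zero-moved n≥3) (ρ-injective (sym e)))

  ρ-symPerm : IsSymPerm ρ
  ρ-symPerm = ((λ b → proj₁ (onto b)) , (λ a → ρ-injective (sym (proj₂ (onto (ρ a))))) , λ b → sym (proj₂ (onto b))) ,
    λ { p _ refl → ρ-symmetric p }
    where onto = injective⇒onto ρ ρ-injective

-- Spreading to the whole cube

-- Interpolates between points with all coordinates in one class (m = 0) and arbitrary points (m =
-- d).
TailClass : ℕ → Point n d → Set
TailClass m x = ∀ i j → m ≤ toℕ i → m ≤ toℕ j → Same (lookup x i) (lookup x j)

tail-near : ∀ {m} {x : Point n d} (a : Fin n) → (∀ i → m ≤ toℕ i → Same (lookup x i) a) → TailClass m x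
tail-near a near i j m≤i m≤j = same-trans (near i m≤i) (same-sym (near j m≤j))

-- x differs from points already known to be fixed only in coordinate k or only in its tail;
-- the two lines through x obtained in this way meet nowhere else.
module Propagation (f : LineAut n d) (m : ℕ) (fixed : ∀ x → TailClass m x → LineAut.to f x ≡ x)
  (x : Point n d) (tail : TailClass (suc m) x) (k l : Fin d) (k≡m : toℕ k ≡ m) (l>m : suc m ≤ toℕ l)
  (a≁b : ¬ Same (lookup x k) (lookup x l)) where
  open LineAut f

  a = lookup x k
  b = lookup x l

  split : ∀ i → m ≤ toℕ i → i ≡ k ⊎ suc m ≤ toℕ i
  split i m≤i with m ℕ.≟ toℕ i
  ... | yes e = inj₁ (toℕ-injective (trans (sym e) (sym k≡m)))
  ... | no ne = inj₂ (ℕ.≤∧≢⇒< m≤i ne)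

  tail≢k : ∀ {i} → suc m ≤ toℕ i → i ≢ k
  tail≢k i>m refl = ℕ.<⇒≢ i>m (sym k≡m)

  coordinate : ∀ j → Dec (suc m ≤ toℕ j) → Fin n ⊎ Bool
  coordinate j (yes j>m) = inj₂ (proj₁ (tail j l j>m l>m))
  coordinate j (no _)    = inj₁ (lookup x j)

  -- The tail of x beyond k is made to run, with x at parameter b. At parameters in the class of a
  -- the tail joins the class of coordinate k, so these points are already fixed.
  L : Pattern n d
  L j = coordinate j (suc m ℕ.≤? toℕ j)

  L-tail : ∀ j → suc m ≤ toℕ j → ∃ λ v → L j ≡ inj₂ v × lookup x j ≡ v · b
  L-tail j j>m = go (suc m ℕ.≤? toℕ j)
    where
    go : (dec : Dec (suc m ≤ toℕ j)) → ∃ λ v → coordinate j dec ≡ inj₂ v × lookup x j ≡ v · b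
    go (yes j>m) = _ , refl , proj₂ (tail j l j>m l>m)
    go (no j≯m)  = ⊥-elim (j≯m j>m)

  L-head : ∀ j → ¬ (suc m ≤ toℕ j) → L j ≡ inj₁ (lookup x j)
  L-head j j≯m = go (suc m ℕ.≤? toℕ j)
    where
    go : (dec : Dec (suc m ≤ toℕ j)) → coordinate j dec ≡ inj₁ (lookup x j)
    go (yes j>m) = ⊥-elim (j≯m j>m)
    go (no _)    = refl

  x∈L : x ∈ L
  x∈L = b , go
    where
    go : ∀ j → lookup x j ≡ ev (L j) b
    go j with suc m ℕ.≤? toℕ j
    ... | yes j>m = proj₂ (tail j l j>m l>m)
    ... | no _    = refl

  L-active : Active L
  L-active = let v , e , _ = L-tail l l>m in l , v , e

  pt-tail : ∀ t j (j>m : suc m ≤ toℕ j) → lookup (pt L t) j ≡ proj₁ (L-tail j j>m) · t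
  pt-tail t j j>m = trans (lookup-pt L t j) (cong (λ c → ev c t) (proj₁ (proj₂ (L-tail j j>m))))

  pt-head : ∀ t j → ¬ (suc m ≤ toℕ j) → lookup (pt L t) j ≡ lookup x j
  pt-head t j j≯m = trans (lookup-pt L t j) (cong (λ c → ev c t) (L-head j j≯m))

  k-head : ¬ (suc m ≤ toℕ k)
  k-head k>m = tail≢k k>m refl

  fixed-on-L : ∀ t → Same t a → to (pt L t) ≡ pt L t
  fixed-on-L t t~a = fixed _ (tail-near {x = pt L t} a near)
    where
    near : ∀ i → m ≤ toℕ i → Same (lookup (pt L t) i) a
    near i m≤i with split i m≤i
    ... | inj₁ refl = false , pt-head t i k-head
    ... | inj₂ i>m  = same-trans (proj₁ (L-tail i i>m) , pt-tail t i i>m) t~a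

  fixed-on-axis : ∀ t → Same t b → to (x [ k ]≔ t) ≡ x [ k ]≔ t
  fixed-on-axis t t~b = fixed _ (tail-near {x = x [ k ]≔ t} b near)
    where
    near : ∀ i → m ≤ toℕ i → Same (lookup (x [ k ]≔ t) i) b
    near i m≤i with split i m≤i
    ... | inj₁ refl = subst (λ c → Same c b) (sym (lookup∘update k x t)) t~b
    ... | inj₂ i>m  = subst (λ c → Same c b) (sym (lookup∘update′ (tail≢k i>m) x t)) (tail i l i>m l>m)

  -- Otherwise `to x` is fixed, and injectivity gives `to x` = x, whose coordinates k and l lie in
  -- different classes.
  ¬tail-image : ¬ TailClass m (to x)
  ¬tail-image tc = a≁b (subst (λ z → Same (lookup z k) (lookup z l)) (to-injective (fixed (to x) tc))
    (tc k l (ℕ.≤-reflexive (sym k≡m)) (ℕ.<⇒≤ l>m)))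

  two-fixed : (K : Pattern n d) → Active K → x ∈ K → ∀ {y z} → y ≢ z → y ∈ K → z ∈ K → to y ≡ y → to z ≡ z → to x ∈ K
  two-fixed K act xK {y} {z} y≢z yK zK fy fz =
    let M , _ , into , _ = to-preserves K act
    in line-unique {L = M} {K} {y} {z} (subst (_∈ M) fy (into y yK)) (subst (_∈ M) fz (into z zK)) yK zK y≢z (to x) (into x xK)

  -- Two fixed points on L keep `to x` on L, so only the tail can change. A changed tail would make
  -- `to x` differ from the fixed point z both in the tail and in k, and `col-moved` would put it
  -- into `TailClass m`.
  via-tail : a ≢ opposite a → to x ≡ x
  via-tail a≢ = lookup-ext agree
    where
    āa : Same (opposite a) a
    āa = true , refl
    y≢z : pt L a ≢ pt L (opposite a)
    y≢z e = a≢ (·-injective (proj₁ (L-tail l l>m))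
      (trans (sym (pt-tail a l l>m)) (trans (cong (λ z → lookup z l) e) (pt-tail (opposite a) l l>m))))
    onL : to x ∈ L
    onL = two-fixed L L-active x∈L y≢z (pt-∈ L a) (pt-∈ L (opposite a)) (fixed-on-L a same-refl) (fixed-on-L _ āa)
    head-agree : ∀ j → ¬ (suc m ≤ toℕ j) → lookup (to x) j ≡ lookup x j
    head-agree j j≯m = trans (proj₂ onL j) (cong (λ c → ev c (proj₁ onL)) (L-head j j≯m))
    z = x [ k ]≔ b
    col : Col (to x) z
    col = subst (Col (to x)) (fixed-on-axis b same-refl) (to-col (∼⇒Col {x = x} {z} (∼-sym (update-∼ x k b))))
    k-moved : lookup (to x) k ≢ lookup z k
    k-moved e = a≁b (false , trans (sym (head-agree k k-head)) (trans e (lookup∘update k x b)))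
    tail-same : ∀ i → suc m ≤ toℕ i → Same (lookup (to x) i) (proj₁ onL)
    tail-same i i>m = proj₁ (L-tail i i>m) , trans (proj₂ onL i) (cong (λ c → ev c (proj₁ onL)) (proj₁ (proj₂ (L-tail i i>m))))
    agree : ∀ j → lookup (to x) j ≡ lookup x j
    agree j with suc m ℕ.≤? toℕ j
    ... | no j≯m = head-agree j j≯m
    ... | yes j>m with lookup (to x) j ≟ lookup z j
    ...   | yes e = trans e (lookup∘update′ (tail≢k j>m) x b)
    ...   | no ne = ⊥-elim (¬tail-image (tail-near {x = to x} (proj₁ onL) near))
      where
      near : ∀ i → m ≤ toℕ i → Same (lookup (to x) i) (proj₁ onL)
      near i m≤i with split i m≤i
      ... | inj₁ refl = same-trans (proj₁ (col-moved {x = to x} {z} col {k} {j} k-moved ne)) (tail-same j j>m)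
      ... | inj₂ i>m  = tail-same i i>m

  -- The same with the roles exchanged: two fixed points keep `to x` on the axis k, and the
  -- comparison is with a point of L.
  via-axis : b ≢ opposite b → to x ≡ x
  via-axis b≢ = ∼-≡ onAxis value
    where
    y≢z : x [ k ]≔ b ≢ x [ k ]≔ opposite b
    y≢z e = b≢ (trans (sym (lookup∘update k x b)) (trans (cong (λ z → lookup z k) e) (lookup∘update k x (opposite b))))
    onAxis : to x ∼[ k ] x
    onAxis = ∈axis⇒∼ (two-fixed (axis x k) (axis-active x k) (∼⇒∈axis {x = x} ∼-refl) y≢z
      (∼⇒∈axis (update-∼ x k b)) (∼⇒∈axis (update-∼ x k (opposite b))) (fixed-on-axis b same-refl) (fixed-on-axis _ (true , refl)))
    z = pt L a
    col : Col (to x) z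
    col = subst (Col (to x)) (fixed-on-L a same-refl) (to-col (L , L-active , x∈L , pt-∈ L a))
    xl : lookup (to x) l ≡ b
    xl = off onAxis l (tail≢k l>m)
    l-moved : lookup (to x) l ≢ lookup z l
    l-moved e = a≁b (same-trans (same-sym (proj₁ (L-tail l l>m) , pt-tail a l l>m)) (false , trans (sym e) xl))
    value : lookup (to x) k ≡ lookup x k
    value with lookup (to x) k ≟ lookup z k
    ... | yes e = trans e (pt-head a k k-head)
    ... | no ne = ⊥-elim (¬tail-image (tail-near {x = to x} b near))
      where
      near : ∀ i → m ≤ toℕ i → Same (lookup (to x) i) b
      near i m≤i with split i m≤i
      ... | inj₁ refl = same-trans (proj₁ (col-moved {x = to x} {z} col {k} {l} ne l-moved)) (false , xl)
      ... | inj₂ i>m  = same-trans (false , off onAxis i (tail≢k i>m)) (tail i l i>m l>m)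

  fixed-x : to x ≡ x
  fixed-x with a ≟ opposite a
  ... | no a≢ = via-tail a≢
  -- Reflection fixes at most one value, so b is moved when a is fixed.
  ... | yes a-mid = via-axis λ b-mid → a≁b (false , fixed-unique a-mid b-mid)

fixes-all : (f : LineAut n d) → let open LineAut f in
  (∀ x → (∀ i j → Same (lookup x i) (lookup x j)) → to x ≡ x) → ∀ x → to x ≡ x
fixes-all {n} {d} f diagonal x = go d x λ i _ d≤i → ⊥-elim (ℕ.<⇒≱ (toℕ<n i) d≤i)
  where
  open LineAut f
  go : ∀ m x → TailClass m x → to x ≡ x
  go zero    x tc = diagonal x λ i j → tc i j z≤n z≤n
  go (suc m) x tc with suc m ℕ.<? d
  -- At most one coordinate has index m or larger, so the condition for m is trivial.
  ... | no sm≮d = go m x λ i j m≤i m≤j → false , cong (lookup x) (toℕ-injective (trans (last i m≤i) (sym (last j m≤j))))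
    where
    last : ∀ i → m ≤ toℕ i → toℕ i ≡ m
    last i m≤i = ℕ.≤-antisym (ℕ.≤-pred (ℕ.≤-trans (toℕ<n i) (ℕ.≮⇒≥ sm≮d))) m≤i
  ... | yes sm<d with same? (lookup x (fromℕ< (ℕ.<-trans (ℕ.n<1+n m) sm<d))) (lookup x (fromℕ< sm<d))
  ...   | no a≁b = Propagation.fixed-x f m (go m) x tc _ _ (toℕ-fromℕ< _) (ℕ.≤-reflexive (sym (toℕ-fromℕ< sm<d))) a≁b
  ...   | yes a~b = go m x (tail-near {x = x} (lookup x (fromℕ< sm<d)) near)
    where
    near : ∀ i → m ≤ toℕ i → Same (lookup x i) (lookup x (fromℕ< sm<d))
    near i m≤i with m ℕ.≟ toℕ i
    ... | yes e = same-trans (false , cong (lookup x) (toℕ-injective (trans (sym e) (sym (toℕ-fromℕ< _))))) a~b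
    ... | no ne = tc i _ (ℕ.≤∧≢⇒< m≤i ne) (ℕ.≤-reflexive (sym (toℕ-fromℕ< sm<d)))

-- Standard form of an automorphism

record Standard (f : Point n d → Point n d) : Set where
  field
    ε         : Fin d → Bool
    τ τ⁻      : Fin d → Fin d
    ττ⁻       : ∀ j → τ (τ⁻ j) ≡ j
    τ⁻τ       : ∀ j → τ⁻ (τ j) ≡ j
    π         : Fin n → Fin n
    π-symPerm : IsSymPerm π
    form      : ∀ x → f x ≡ signed ε τ (F π x)

candidate : 3 ≤ n → ∃ λ (c : Fin n) → Candidate c
candidate {n} n≥3 with any? (λ (a : Fin n) → a ≟ opposite a)
... | yes (m , e) = m , λ _ _ → e
... | no ¬mid     = proj₁ (zero-moved n≥3) , λ b e → ⊥-elim (¬mid (b , e))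

-- The inverse automorphism carries the axes through `to p` back, and two distinct points determine
-- the direction of their axis.
axes-bijective : 3 ≤ n → 2 ≤ d → (f : LineAut n d) → ∀ {p} → Central p → let open LineAut f in
  ∃ λ (τ : Fin d → Fin d) → ∃ λ (τ⁻ : Fin d → Fin d) → (∀ j → τ (τ⁻ j) ≡ j) × (∀ i → τ⁻ (τ i) ≡ i) ×
  (∀ i y → y ∼[ i ] p → to y ∼[ τ i ] to p)
axes-bijective {n} {d} n≥3 d≥2 f {p} pc = τ , τ⁻ , ττ⁻ , τ⁻τ , λ i → proj₂ (axis-image n≥3 d≥2 f pc i)
  where
  open LineAut f
  tpc = central-image n≥3 d≥2 f p pc
  τ τ⁻ : Fin d → Fin d
  τ i = proj₁ (axis-image n≥3 d≥2 f pc i)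
  τ⁻ j = proj₁ (axis-image n≥3 d≥2 (inverse f) tpc j)
  back : ∀ j y → y ∼[ j ] to p → from y ∼[ τ⁻ j ] p
  back j y y∼ = subst (from y ∼[ τ⁻ j ]_) (from-to p) (proj₂ (axis-image n≥3 d≥2 (inverse f) tpc j) y y∼)
  axis-unique : ∀ {i j} {x y : Point n d} → x ≢ y → x ∼[ i ] y → x ∼[ j ] y → i ≡ j
  axis-unique {i} {j} x≢y x∼ x∼′ with i ≟ j
  ... | yes e = e
  ... | no ne = ⊥-elim (x≢y (∼-≡ x∼ (off x∼′ i ne)))
  off-p : (q : Point n d) (i : Fin d) → ∃ λ y → y ∼[ i ] q × y ≢ q
  off-p q i = let r , r≁ = outside-class n≥3 (lookup q i) in q [ i ]≔ r , update-∼ q i r ,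
    λ e → r≁ (false , trans (sym (lookup∘update i q r)) (cong (λ z → lookup z i) e))
  τ⁻τ : ∀ i → τ⁻ (τ i) ≡ i
  τ⁻τ i = let y , y∼p , y≢p = off-p p i in
    axis-unique y≢p (subst (_∼[ τ⁻ (τ i) ] p) (from-to y) (back (τ i) (to y) (proj₂ (axis-image n≥3 d≥2 f pc i) y y∼p))) y∼p
  ττ⁻ : ∀ j → τ (τ⁻ j) ≡ j
  ττ⁻ j = let y , y∼p , y≢p = off-p (to p) j in
    axis-unique y≢p (subst (_∼[ τ (τ⁻ j) ] to p) (to-from y) (proj₂ (axis-image n≥3 d≥2 f pc (τ⁻ j)) (from y) (back j y y∼p))) y∼p

standard : 3 ≤ n → 2 ≤ d → (f : LineAut n d) → Standard (LineAut.to f)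
standard {n} {d@(suc _)} n≥3 d≥2 f = record
  -- The axis i goes to the axis `τ i`, so coordinate j of the image is read off coordinate `τ⁻ j`:
  -- the two maps exchange roles.
  { ε = ε ; τ = τ⁻ ; τ⁻ = τ ; ττ⁻ = τ⁻τ ; τ⁻τ = ττ⁻ ; π = ρ ; π-symPerm = ρ-symPerm
  ; form = λ x → trans (sym (LineAut.to-from S (to x))) (cong (LineAut.to S) (normal x)) }
  where
  open LineAut f
  c = proj₁ (candidate n≥3)
  c-cand = proj₂ (candidate n≥3)
  p₀ : Point n d
  p₀ = replicate d c
  p₀-central : Central p₀
  p₀-central = corner-central c-cand λ j → false , lookup-replicate j c
  axes-data = axes-bijective n≥3 d≥2 f p₀-central
  τ = proj₁ axes-data
  τ⁻ = proj₁ (proj₂ axes-data)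
  ττ⁻ = proj₁ (proj₂ (proj₂ axes-data))
  τ⁻τ = proj₁ (proj₂ (proj₂ (proj₂ axes-data)))
  f-axes = proj₂ (proj₂ (proj₂ (proj₂ axes-data)))
  τ-injective : ∀ {i k} → τ i ≡ τ k → i ≡ k
  τ-injective {i} {k} e = trans (sym (τ⁻τ i)) (trans (cong τ⁻ e) (τ⁻τ k))
  Δ : Pattern n d
  Δ _ = inj₂ false
  diagonal = to-preserves Δ (zero , false , refl)
  M = proj₁ diagonal
  on-M : ∀ t → to (replicate d t) ∈ M
  on-M t = proj₁ (proj₂ (proj₂ diagonal)) (replicate d t) (t , λ j → lookup-replicate j t)

  -- If the image of the main diagonal were constant in j, then by `star` two points of the axis
  -- `τ⁻ j` through p₀ would have the same image.
  M-full : ∀ j → ∃ λ v → M j ≡ inj₂ v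
  M-full j = go (M j) refl
    where
    go : ∀ k → M j ≡ k → ∃ λ v → k ≡ inj₂ v
    go (inj₂ v) e = v , refl
    go (inj₁ a) e = ⊥-elim (y≢ (to-injective (∼-≡ (f-axes i y (update-∼ p₀ i _)) same-value)))
      where
      constant-at : ∀ t → lookup (to (replicate d t)) j ≡ a
      constant-at t = trans (proj₂ (on-M t) j) (cong (λ k → ev k (proj₁ (on-M t))) e)
      i = τ⁻ j
      s = proj₁ (outside-class n≥3 c)
      s≁c = proj₂ (outside-class n≥3 c)
      x : Point n d
      x = replicate d s
      y = p₀ [ i ]≔ lookup x i
      y≢ : y ≢ p₀
      y≢ e = s≁c (false , trans (sym (lookup-replicate i s)) (trans (sym (lookup∘update i p₀ (lookup x i)))
        (trans (cong (λ z → lookup z i) e) (lookup-replicate i c))))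
      same-value : lookup (to y) (τ i) ≡ lookup (to p₀) (τ i)
      same-value = trans (sym (star n≥3 d≥2 f (λ _ → false) c-cand s≁c (λ j → lookup-replicate j c) (λ j → lookup-replicate j s) τ τ-injective f-axes i))
        (subst (λ j′ → lookup (to x) j′ ≡ lookup (to p₀) j′) (sym (ττ⁻ j)) (trans (constant-at s) (sym (constant-at c))))

  -- The image M of the main diagonal supplies the signs ε and also ρ, the parameter on M of the
  -- image of (t, ..., t).
  ε : Fin d → Bool
  ε j = proj₁ (M-full j)
  S : LineAut n d
  S = signedAut ε τ⁻ τ τ⁻τ ττ⁻
  ρ : Fin n → Fin n
  ρ t = proj₁ (on-M t)
  f′ : LineAut n d
  f′ = inverse S ∘ᴸ f
  constants : ∀ t → LineAut.to f′ (replicate d t) ≡ replicate d (ρ t)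
  constants t = lookup-ext λ j → trans (lookup-signed (ε ∘ τ) τ (to (replicate d t)) j)
    (trans (cong (ε (τ j) ·_) (trans (proj₂ (on-M t) (τ j)) (cong (λ k → ev k (ρ t)) (proj₂ (M-full (τ j))))))
    (trans (·-self (ε (τ j)) (ρ t)) (sym (lookup-replicate j (ρ t)))))
  axes′ : ∀ i y → y ∼[ i ] p₀ → LineAut.to f′ y ∼[ i ] LineAut.to f′ p₀
  axes′ i y y∼ = mk∼ λ j j≢i → trans (lookup-signed (ε ∘ τ) τ (to y) j)
    (trans (cong (ε (τ j) ·_) (off (f-axes i y y∼) (τ j) (j≢i ∘ τ-injective))) (sym (lookup-signed (ε ∘ τ) τ (to p₀) j)))
  open Normalised n≥3 d≥2 f′ zero c c-cand ρ constants axes′ using (ρ-symPerm; one-class-image)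
  Φ : LineAut n d
  Φ = FAut ρ-symPerm
  -- Undoing F_ρ after f′ leaves an automorphism that fixes every point with coordinates in one
  -- class, hence every point.
  normal : ∀ x → LineAut.to f′ x ≡ F ρ x
  normal x = trans (sym (LineAut.to-from Φ (LineAut.to f′ x))) (cong (F ρ) (fixes-all (inverse Φ ∘ᴸ f′)
    (λ x one → trans (cong (LineAut.from Φ) (one-class-image x one)) (LineAut.from-to Φ x)) x))

-- The generators preserve lines

R-left : {i j : Fin d} → i ≢ j → (x : Point n d) → lookup (R i j x) i ≡ opposite (lookup x j)
R-left {i = i} {j} i≢j x = trans (lookup∘update′ i≢j (x [ i ]≔ _) _) (lookup∘update i x _)

R-right : (i j : Fin d) (x : Point n d) → lookup (R i j x) j ≡ lookup x i
R-right i j x = lookup∘update j (x [ i ]≔ _) _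

R-other : (i j : Fin d) (x : Point n d) → ∀ {k} → k ≢ i → k ≢ j → lookup (R i j x) k ≡ lookup x k
R-other i j x k≢i k≢j = trans (lookup∘update′ k≢j (x [ i ]≔ _) _) (lookup∘update′ k≢i x _)

R-inverse : {i j : Fin d} → i ≢ j → (x : Point n d) → R j i (R i j x) ≡ x
R-inverse {i = i} {j} i≢j x = lookup-ext go
  where
  go : ∀ k → lookup (R j i (R i j x)) k ≡ lookup x k
  go k with k ≟ i | k ≟ j
  ... | yes refl | _        = trans (R-right j k (R k j x)) (R-right k j x)
  ... | no _     | yes refl = trans (R-left (i≢j ∘ sym) (R i k x)) (trans (cong opposite (R-left i≢j x)) (opposite-involutive _))
  ... | no k≢i   | no k≢j   = trans (R-other j i (R i j x) k≢j k≢i) (R-other i j x k≢i k≢j)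

R-preserves : {i j : Fin d} → i ≢ j → PreservesLines {n} (R i j)
R-preserves {d} {n} {i} {j} i≢j = signed-preserves (λ k → does (k ≟ i)) (transpose i j) (transpose j i)
  (λ _ → transpose-inverse i j) form
  where
  form : ∀ (x : Point n d) k → lookup (R i j x) k ≡ does (k ≟ i) · lookup x (transpose i j k)
  form x k with k ≟ i
  ... | yes refl = R-left i≢j x
  ... | no k≢i with k ≟ j
  ...   | yes refl = R-right i k x
  ...   | no k≢j   = R-other i j x k≢i k≢j

swap-last : Fin d → Fin d
swap-last {1}                 i       = i
swap-last {2}                 zero    = suc zero
swap-last {2}                 (suc i) = zero
swap-last {suc (suc (suc d))} zero    = zero
swap-last {suc (suc (suc d))} (suc i) = suc (swap-last i)

swap-last-involutive : (i : Fin d) → swap-last (swap-last i) ≡ i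
swap-last-involutive {1}                 i          = refl
swap-last-involutive {2}                 zero       = refl
swap-last-involutive {2}                 (suc zero) = refl
swap-last-involutive {suc (suc (suc d))} zero       = refl
swap-last-involutive {suc (suc (suc d))} (suc i)    = cong suc (swap-last-involutive i)

lookup-X : (x : Point n d) → ∀ k → lookup (X x) k ≡ lookup x (swap-last k)
lookup-X (a ∷ [])        k          = refl
lookup-X (a ∷ b ∷ [])    zero       = refl
lookup-X (a ∷ b ∷ [])    (suc zero) = refl
lookup-X (a ∷ b ∷ c ∷ x) zero       = refl
lookup-X (a ∷ b ∷ c ∷ x) (suc k)    = lookup-X (b ∷ c ∷ x) k

X-involutive : (x : Point n d) → X (X x) ≡ x
X-involutive x = lookup-ext λ k → trans (lookup-X (X x) k) (trans (lookup-X x (swap-last k)) (cong (lookup x) (swap-last-involutive k)))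

X-preserves : PreservesLines {n} {d} X
X-preserves = signed-preserves (λ _ → false) swap-last swap-last swap-last-involutive lookup-X

id-preserves : PreservesLines {n} {d} id
id-preserves L act = L , act , (λ _ x∈L → x∈L) , λ y y∈L → y , y∈L , refl

generated-preserves : {f : Point n d → Point n d} → Generated n d f → IsPermutation f × PreservesLines f
generated-preserves (base (gR i j i≢j)) = (R j i , R-inverse i≢j , R-inverse (i≢j ∘ sym)) , R-preserves i≢j
generated-preserves (base (gF π s)) = (LineAut.from Φ , LineAut.from-to Φ , LineAut.to-from Φ) , F-preserves s
  where Φ = FAut s
generated-preserves (base gId) = (id , (λ _ → refl) , λ _ → refl) , id-preserves
generated-preserves (base gX)  = (X , X-involutive , X-involutive) , X-preserves
generated-preserves idG        = (id , (λ _ → refl) , λ _ → refl) , id-preserves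
generated-preserves (comp {f} {g} gf gg) =
  let (f⁻ , f⁻f , ff⁻) , pf = generated-preserves gf
      (g⁻ , g⁻g , gg⁻) , pg = generated-preserves gg
  in (g⁻ ∘ f⁻ , (λ x → trans (cong g⁻ (f⁻f (g x))) (g⁻g x)) , λ x → trans (cong f (gg⁻ (f⁻ x))) (ff⁻ x)) , preserves-∘ pf pg
generated-preserves (inv {f} {g} gf gf≡ fg≡) =
  (f , fg≡ , gf≡) , inverse-preserves gf≡ fg≡ (proj₂ (generated-preserves gf))

-- Generating all maps in standard form

Generable : (Point n d → Point n d) → Set
Generable {n} {d} f = ∃ λ g → Generated n d g × g ≗ₚ f

generable-resp : {f g : Point n d → Point n d} → f ≗ₚ g → Generable f → Generable g
generable-resp f≗g (h , gen , h≗f) = h , gen , λ x → trans (h≗f x) (f≗g x)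

generable-∘ : {f g : Point n d → Point n d} → Generable f → Generable g → Generable (f ∘ g)
generable-∘ {f = f} (f′ , genf , f≗) (g′ , geng , g≗) = f′ ∘ g′ , comp genf geng , λ x → trans (f≗ (g′ x)) (cong f (g≗ x))

generator : {f : Point n d → Point n d} → Generator n d f → Generable f
generator g = _ , base g , λ _ → refl

penultimate ultimate : ∀ d → Fin (suc (suc d))
penultimate zero    = zero
penultimate (suc d) = suc (penultimate d)
ultimate zero    = suc zero
ultimate (suc d) = suc (ultimate d)

penultimate≢ultimate : ∀ d → penultimate d ≢ ultimate d
penultimate≢ultimate (suc d) e = penultimate≢ultimate d (suc-injective e)

swap-last-ultimate : ∀ d → swap-last (ultimate d) ≡ penultimate d
swap-last-ultimate zero    = refl
swap-last-ultimate (suc d) = cong suc (swap-last-ultimate d)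

swap-last-penultimate : ∀ d → swap-last (penultimate d) ≡ ultimate d
swap-last-penultimate d = trans (cong swap-last (sym (swap-last-ultimate d))) (swap-last-involutive (ultimate d))

swap-last-other : ∀ d {k} → k ≢ penultimate d → k ≢ ultimate d → swap-last k ≡ k
swap-last-other zero    {zero}     ≢p ≢u = ⊥-elim (≢p refl)
swap-last-other zero    {suc zero} ≢p ≢u = ⊥-elim (≢u refl)
swap-last-other (suc d) {zero}     ≢p ≢u = refl
swap-last-other (suc d) {suc k}    ≢p ≢u = cong suc (swap-last-other d (≢p ∘ cong suc) (≢u ∘ cong suc))

reflect : Fin d → Point n d → Point n d
reflect i x = x [ i ]≔ opposite (lookup x i)

reflect-here : (i : Fin d) (x : Point n d) → lookup (reflect i x) i ≡ opposite (lookup x i)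
reflect-here i x = lookup∘update i x _

reflect-there : (i : Fin d) (x : Point n d) → ∀ {k} → k ≢ i → lookup (reflect i x) k ≡ lookup x k
reflect-there i x k≢i = lookup∘update′ k≢i x _

-- X undoes the exchange made by R and leaves its sign, now at the last coordinate.
X∘R≗reflect : ∀ e → (X ∘ R {n} (penultimate e) (ultimate e)) ≗ₚ reflect (ultimate e)
X∘R≗reflect {n} e x = lookup-ext go
  where
  p = penultimate e
  u = ultimate e
  at-X : ∀ {j} k → swap-last k ≡ j → lookup (X (R p u x)) k ≡ lookup (R p u x) j
  at-X k e = trans (lookup-X (R p u x) k) (cong (lookup (R p u x)) e)
  go : ∀ k → lookup (X (R p u x)) k ≡ lookup (reflect u x) k
  go k with k ≟ u | k ≟ p
  ... | yes refl | _        = trans (at-X u (swap-last-ultimate e)) (trans (R-left (penultimate≢ultimate e) x) (sym (reflect-here u x)))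
  ... | no k≢u   | yes refl = trans (at-X p (swap-last-penultimate e)) (trans (R-right p u x) (sym (reflect-there u x k≢u)))
  ... | no k≢u   | no k≢p   = trans (at-X k (swap-last-other e k≢p k≢u)) (trans (R-other p u x k≢p k≢u) (sym (reflect-there u x k≢u)))

-- `R u i` is the inverse of `R i u`, so this is a conjugation, which carries a reflection from u to
-- i.
conjugate-reflect : {i u : Fin d} → i ≢ u → (R {n} u i ∘ reflect u ∘ R i u) ≗ₚ reflect i
conjugate-reflect {d} {n} {i} {u} i≢u x = lookup-ext go
  where
  y = R i u x
  z = reflect u y
  go : ∀ k → lookup (R u i z) k ≡ lookup (reflect i x) k
  go k with k ≟ i | k ≟ u
  ... | yes refl | _        = trans (R-right u k z) (trans (reflect-here u y) (trans (cong opposite (R-right k u x)) (sym (reflect-here k x))))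
  ... | no k≢i   | yes refl = trans (R-left (i≢u ∘ sym) z) (trans (cong opposite (trans (reflect-there k y i≢u) (R-left i≢u x)))
                                (trans (opposite-involutive _) (sym (reflect-there i x k≢i))))
  ... | no k≢i   | no k≢u   = trans (R-other u i z k≢u k≢i) (trans (reflect-there u y k≢u)
                                (trans (R-other i u x k≢i k≢u) (sym (reflect-there i x k≢i))))

last-reflect-generable : ∀ e → Generable {n} (reflect (ultimate e))
last-reflect-generable e = generable-resp (X∘R≗reflect e)
  (generable-∘ (generator gX) (generator (gR _ _ (penultimate≢ultimate e))))

reflect-generable : 2 ≤ d → (i : Fin d) → Generable {n} (reflect i)
reflect-generable {suc (suc e)} {n} (s≤s (s≤s z≤n)) i with i ≟ ultimate e
... | yes refl = last-reflect-generable e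
... | no i≢u = generable-resp (conjugate-reflect i≢u) (generable-∘ (generator (gR _ _ (i≢u ∘ sym)))
        (generable-∘ (last-reflect-generable e) (generator (gR _ _ i≢u))))

permute : (Fin d → Fin d) → Point n d → Point n d
permute = signed (λ _ → false)

lookup-permute : (τ : Fin d → Fin d) (x : Point n d) → ∀ j → lookup (permute τ x) j ≡ lookup x (τ j)
lookup-permute = lookup-signed (λ _ → false)

-- Reflecting coordinate i cancels the sign in `R i j` and leaves the transposition.
transpose-generable : 2 ≤ d → (i j : Fin d) → Generable {n} (permute (transpose i j))
transpose-generable {d} {n} d≥2 i j with i ≟ j
... | yes refl = id , idG , λ x → lookup-ext λ k → sym (trans (lookup-permute (transpose i i) x k) (cong (lookup x) (trivial k)))
  where
  trivial : ∀ k → transpose i i k ≡ k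
  trivial k with k ≟ i
  ... | yes refl = refl
  ... | no k≢i rewrite dec-false (k ≟ i) k≢i = refl
... | no i≢j = generable-resp (λ x → lookup-ext λ k → trans (go x k) (sym (lookup-permute (transpose i j) x k)))
        (generable-∘ (reflect-generable d≥2 i) (generator (gR i j i≢j)))
  where
  go : ∀ (x : Point n d) k → lookup (reflect i (R i j x)) k ≡ lookup x (transpose i j k)
  go x k with k ≟ i
  ... | yes refl = trans (reflect-here k (R k j x)) (trans (cong opposite (R-left i≢j x)) (opposite-involutive _))
  ... | no k≢i with k ≟ j
  ...   | yes refl = trans (reflect-there i (R i k x) k≢i) (R-right i k x)
  ...   | no k≢j   = trans (reflect-there i (R i j x) k≢i) (R-other i j x k≢i k≢j)

eval-generable : 2 ≤ d → (xs : TranspositionList d) → Generable {n} (permute (eval xs ⟨$⟩ʳ_))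
eval-generable d≥2 []             = id , idG , λ x → lookup-ext λ k → sym (lookup-permute id x k)
eval-generable d≥2 ((i , j) ∷ xs) = generable-resp
  (λ x → lookup-ext λ k → trans (lookup-permute (transpose i j) (permute (eval xs ⟨$⟩ʳ_) x) k)
    (trans (lookup-permute (eval xs ⟨$⟩ʳ_) x (transpose i j k)) (sym (lookup-permute (eval ((i , j) ∷ xs) ⟨$⟩ʳ_) x k))))
  (generable-∘ (transpose-generable d≥2 i j) (eval-generable d≥2 xs))

-- Negative signs occur only at indices below m; each step of the induction removes the last
-- possible one by a reflection.
signs-generable : 2 ≤ d → ∀ m (ε : Fin d → Bool) → (∀ j → m ≤ toℕ j → ε j ≡ false) → Generable {n} (signed ε id)
signs-generable d≥2 zero ε tail = id , idG , λ x → lookup-ext λ k →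
  sym (trans (lookup-signed ε id x k) (cong (_· lookup x k) (tail k z≤n)))
signs-generable {d} {n} d≥2 (suc m) ε tail with m ℕ.<? d
... | no m≮d = signs-generable d≥2 m ε λ j m≤j → ⊥-elim (m≮d (ℕ.≤-<-trans m≤j (toℕ<n j)))
... | yes m<d with ε (fromℕ< m<d) in εk
...   | false = signs-generable d≥2 m ε tail′
  where
  tail′ : ∀ j → m ≤ toℕ j → ε j ≡ false
  tail′ j m≤j with j ≟ fromℕ< m<d
  ... | yes refl = εk
  ... | no j≢k   = tail j (ℕ.≤∧≢⇒< m≤j λ e → j≢k (toℕ-injective (trans (sym e) (sym (toℕ-fromℕ< m<d)))))
...   | true = generable-resp (λ x → lookup-ext λ j → go x j) (generable-∘ (reflect-generable d≥2 k) (signs-generable d≥2 m ε′ tail′))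
  where
  k = fromℕ< m<d
  ε′ : Fin d → Bool
  ε′ = updateAt ε k (λ _ → false)
  tail′ : ∀ j → m ≤ toℕ j → ε′ j ≡ false
  tail′ j m≤j with j ≟ k
  ... | yes refl = updateAt-updates k ε
  ... | no j≢k   = trans (updateAt-minimal j k ε j≢k)
          (tail j (ℕ.≤∧≢⇒< m≤j λ e → j≢k (toℕ-injective (trans (sym e) (sym (toℕ-fromℕ< m<d))))))
  go : ∀ (x : Point n d) j → lookup (reflect k (signed ε′ id x)) j ≡ lookup (signed ε id x) j
  go x j with j ≟ k
  ... | yes refl = trans (reflect-here k (signed ε′ id x)) (trans (cong opposite (trans (lookup-signed ε′ id x k)
          (cong (_· lookup x k) (updateAt-updates k ε)))) (sym (trans (lookup-signed ε id x k) (cong (_· lookup x k) εk))))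
  ... | no j≢k   = trans (reflect-there k (signed ε′ id x) j≢k) (trans (lookup-signed ε′ id x j)
          (trans (cong (_· lookup x j) (updateAt-minimal j k ε j≢k)) (sym (lookup-signed ε id x j))))

standard-generable : 2 ≤ d → {f : Point n d → Point n d} → Standard f → Generable f
standard-generable {d} d≥2 st = generable-resp
  (λ x → sym (trans (form x) (lookup-ext λ j → trans (lookup-signed ε τ (F π x) j)
    (sym (trans (lookup-signed ε id (permute (σ ⟨$⟩ʳ_) (F π x)) j) (cong (ε j ·_)
      (trans (lookup-permute (σ ⟨$⟩ʳ_) (F π x) j) (cong (lookup (F π x)) (eval-decompose τ-perm j)))))))))
  (generable-∘ (signs-generable d≥2 d ε λ j d≤j → ⊥-elim (ℕ.<⇒≱ (toℕ<n j) d≤j))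
    (generable-∘ (eval-generable d≥2 (decompose τ-perm)) (generator (gF π π-symPerm))))
  where
  open Standard st
  τ-perm : Permutation′ d
  τ-perm = permutation τ τ⁻ ττ⁻ τ⁻τ
  σ = eval (decompose τ-perm)

-- Numbering permutations and bit strings

-- Mixed-radix numbering: the leading digit is the image of 0, the rest numbers the permutation left
-- after removing 0.
perm : ∀ m → Fin (m !) → Permutation′ m
perm zero    _ = Perm.id
perm (suc m) c = insert zero (proj₁ (remQuot {suc m} (m !) c)) (perm m (proj₂ (remQuot {suc m} (m !) c)))

remQuot-injective : ∀ m k (c c′ : Fin (m * k)) → proj₁ (remQuot {m} k c) ≡ proj₁ (remQuot {m} k c′) →
  proj₂ (remQuot {m} k c) ≡ proj₂ (remQuot {m} k c′) → c ≡ c′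
remQuot-injective m k c c′ e₁ e₂ =
  trans (sym (combine-remQuot {m} k c)) (trans (cong₂ (combine {m} {k}) e₁ e₂) (combine-remQuot {m} k c′))

perm-injective : ∀ m (c c′ : Fin (m !)) → perm m c ≈ perm m c′ → c ≡ c′
perm-injective zero    zero zero _ = refl
perm-injective (suc m) c c′ h = remQuot-injective (suc m) (m !) c c′ (h zero)
  (perm-injective m _ _ λ k → punchIn-injective (proj₁ (remQuot {suc m} (m !) c)) _ _ (trans (sym (insert-punchIn zero _ (rest c) k))
    (trans (h (suc k)) (trans (insert-punchIn zero _ (rest c′) k) (cong (λ i → punchIn i (rest c′ ⟨$⟩ʳ k)) (sym (h zero)))))))
  where
  rest : Fin (suc m !) → Permutation′ m
  rest c = perm m (proj₂ (remQuot {suc m} (m !) c))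

perm-onto : ∀ m (π : Permutation′ m) → ∃ λ c → perm m c ≈ π
perm-onto zero    π = zero , λ ()
perm-onto (suc m) π = combine (π ⟨$⟩ʳ zero) c , λ i → trans (decoded i) (trans (insert-≈ i) (insert-remove zero π i))
  where
  c = proj₁ (perm-onto m (remove zero π))
  decoded : perm (suc m) (combine (π ⟨$⟩ʳ zero) c) ≈ insert zero (π ⟨$⟩ʳ zero) (perm m c)
  decoded i = cong (λ q → insert zero (proj₁ q) (perm m (proj₂ q)) ⟨$⟩ʳ i) (remQuot-combine {suc m} (π ⟨$⟩ʳ zero) c)
  insert-≈ : insert zero (π ⟨$⟩ʳ zero) (perm m c) ≈ insert zero (π ⟨$⟩ʳ zero) (remove zero π)
  insert-≈ zero    = refl
  insert-≈ (suc i) = trans (insert-punchIn zero _ (perm m c) i)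
    (trans (cong (punchIn (π ⟨$⟩ʳ zero)) (proj₂ (perm-onto m (remove zero π)) i)) (sym (insert-punchIn zero _ (remove zero π) i)))

toBool : Fin 2 → Bool
toBool zero       = false
toBool (suc zero) = true

fromBool : Bool → Fin 2
fromBool false = zero
fromBool true  = suc zero

toBool-fromBool : ∀ b → toBool (fromBool b) ≡ b
toBool-fromBool false = refl
toBool-fromBool true  = refl

toBool-injective : ∀ {a b} → toBool a ≡ toBool b → a ≡ b
toBool-injective {zero}     {zero}     _ = refl
toBool-injective {zero}     {suc zero} ()
toBool-injective {suc zero} {zero}     ()
toBool-injective {suc zero} {suc zero} _ = refl

funToFin-cong : ∀ {m k} {f g : Fin m → Fin k} → f ≗ g → funToFin f ≡ funToFin g
funToFin-cong {zero}  h = refl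
funToFin-cong {suc m} h = cong₂ combine (h zero) (funToFin-cong (h ∘ suc))

bits : ∀ m → Fin (2 ^ m) → Fin m → Bool
bits m c i = toBool (finToFun c i)

bits-injective : ∀ m (c c′ : Fin (2 ^ m)) → bits m c ≗ bits m c′ → c ≡ c′
bits-injective m c c′ h = trans (sym (funToFin-finToFin {m} {2} c))
  (trans (funToFin-cong (λ i → toBool-injective (h i))) (funToFin-finToFin {m} {2} c′))

bits-onto : ∀ m (b : Fin m → Bool) → ∃ λ c → bits m c ≗ b
bits-onto m b = funToFin (fromBool ∘ b) , λ i → trans (cong toBool (finToFun-funToFin (fromBool ∘ b) i)) (toBool-fromBool (b i))

-- Symmetric permutations of [n] through signed permutations of the k = ⌊n/2⌋ classes {i, n-1-i}.

module Halves (n k : ℕ) (2k≤n : k + k ≤ n) (n≤2k+1 : n ≤ suc (k + k)) where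

  low : Fin k → Fin n
  low i = inject≤ i (ℕ.≤-trans (ℕ.m≤m+n k k) 2k≤n)

  opposite-sum : (a : Fin n) → suc (toℕ a) + toℕ (opposite a) ≡ n
  opposite-sum a = trans (cong (suc (toℕ a) +_) (opposite-prop a)) (ℕ.m+[n∸m]≡n (toℕ<n a))

  low<k : ∀ i → toℕ (low i) < k
  low<k i = subst (_< k) (sym (toℕ-inject≤ i _)) (toℕ<n i)

  low-injective : ∀ {i j} → low i ≡ low j → i ≡ j
  low-injective {i} {j} e = toℕ-injective (trans (sym (toℕ-inject≤ i _)) (trans (cong toℕ e) (toℕ-inject≤ j _)))

  opposite-low≥k : ∀ i → k ≤ toℕ (opposite (low i))
  opposite-low≥k i = ℕ.+-cancelˡ-≤ k _ _ (ℕ.≤-trans 2k≤n (ℕ.≤-trans (ℕ.≤-reflexive (sym (opposite-sum (low i))))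
    (ℕ.+-monoˡ-≤ _ (low<k i))))

  low-apart : ∀ i j → low i ≢ opposite (low j)
  low-apart i j e = ℕ.<⇒≱ (low<k i) (subst (λ a → k ≤ toℕ a) (sym e) (opposite-low≥k j))

  signed-low-injective : ∀ u v {i j} → u · low i ≡ v · low j → u ≡ v × i ≡ j
  signed-low-injective false false e = refl , low-injective e
  signed-low-injective false true  e = ⊥-elim (low-apart _ _ e)
  signed-low-injective true  false e = ⊥-elim (low-apart _ _ (sym e))
  signed-low-injective true  true  e = refl , low-injective (·-injective true e)

  low-moved : ∀ v i → v · low i ≢ opposite (v · low i)
  low-moved v i e = low-apart i i (·-fixed⁻ v e)

  -- In the last case a and its reflection are both at least k, while their sum n - 1 is at most 2k;
  -- so both equal k.
  classify : ∀ a → (∃ λ i → ∃ λ v → a ≡ v · low i) ⊎ a ≡ opposite a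
  classify a with toℕ a ℕ.<? k | toℕ (opposite a) ℕ.<? k
  ... | yes a<k | _       = inj₁ (fromℕ< a<k , false , toℕ-injective (sym (trans (toℕ-inject≤ _ _) (toℕ-fromℕ< a<k))))
  ... | no _    | yes ā<k = inj₁ (fromℕ< ā<k , true , trans (sym (opposite-involutive a))
                              (cong opposite (toℕ-injective (sym (trans (toℕ-inject≤ _ _) (toℕ-fromℕ< ā<k))))))
  ... | no a≮k  | no ā≮k  = inj₂ (toℕ-injective (trans (equals-k (toℕ a) _ (ℕ.≮⇒≥ a≮k) (ℕ.≮⇒≥ ā≮k) sum≤)
                              (sym (equals-k _ (toℕ a) (ℕ.≮⇒≥ ā≮k) (ℕ.≮⇒≥ a≮k) (subst (_≤ k + k) (ℕ.+-comm (toℕ a) _) sum≤)))))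
    where
    sum≤ : toℕ a + toℕ (opposite a) ≤ k + k
    sum≤ = ℕ.≤-pred (ℕ.≤-trans (ℕ.≤-reflexive (opposite-sum a)) n≤2k+1)
    equals-k : ∀ x y → k ≤ x → k ≤ y → x + y ≤ k + k → x ≡ k
    equals-k x y k≤x k≤y le = ℕ.≤-antisym (ℕ.+-cancelʳ-≤ k x k (ℕ.≤-trans (ℕ.+-monoʳ-≤ x k≤y) le)) k≤x

  -- `β i` tells whether the pair of i is turned over on its way to the pair of `κ i`; a middle
  -- value stays.
  extend : (Fin k → Fin k) → (Fin k → Bool) → Fin n → Fin n
  extend κ β a with classify a
  ... | inj₁ (i , v , _) = (v xor β i) · low (κ i)
  ... | inj₂ _           = a

  extend-low : ∀ κ β v i → extend κ β (v · low i) ≡ v · β i · low (κ i)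
  extend-low κ β v i with classify (v · low i)
  ... | inj₂ e = ⊥-elim (low-moved v i e)
  ... | inj₁ (j , u , e) with signed-low-injective v u e
  ...   | refl , refl = sym (·-xor v (β i) _)

  extend-mid : ∀ κ β {a} → a ≡ opposite a → extend κ β a ≡ a
  extend-mid κ β {a} e with classify a
  ... | inj₁ (i , v , refl) = ⊥-elim (low-moved v i e)
  ... | inj₂ _              = refl

  extend-inverse : ∀ κ κ⁻ β → (∀ i → κ⁻ (κ i) ≡ i) → ∀ a → extend κ⁻ (β ∘ κ⁻) (extend κ β a) ≡ a
  extend-inverse κ κ⁻ β κ⁻κ a with classify a
  ... | inj₂ e = extend-mid κ⁻ (β ∘ κ⁻) e
  ... | inj₁ (i , v , refl) = trans (extend-low κ⁻ (β ∘ κ⁻) (v xor β i) (κ i))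
          (trans (cong (λ j → (v xor β i) · β j · low j) (κ⁻κ i))
          (trans (sym (·-xor v (β i) _)) (cong (v ·_) (·-self (β i) _))))

  extend-symPerm : (κ : Permutation′ k) (β : Fin k → Bool) → IsSymPerm (extend (κ ⟨$⟩ʳ_) β)
  extend-symPerm κ β =
    (extend κ⁻ (β ∘ κ⁻) , extend-inverse κʳ κ⁻ β (λ _ → inverseˡ κ) , onto) ,
    λ { p _ refl → symmetric p }
    where
    κʳ = κ ⟨$⟩ʳ_
    κ⁻ = κ ⟨$⟩ˡ_
    symmetric : ∀ p → extend κʳ β (opposite p) ≡ opposite (extend κʳ β p)
    symmetric p with classify p
    ... | inj₂ e = trans (cong (extend κʳ β) (sym e)) (trans (extend-mid κʳ β e) e)
    ... | inj₁ (i , v , refl) = trans (cong (extend κʳ β) (·-xor true v (low i)))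
            (trans (extend-low κʳ β (true xor v) i) (trans (sym (·-xor true v _)) (cong opposite (·-xor v (β i) _))))
    onto : ∀ b → extend κʳ β (extend κ⁻ (β ∘ κ⁻) b) ≡ b
    onto b with classify b
    ... | inj₂ e = extend-mid κʳ β e
    ... | inj₁ (i , v , refl) = trans (extend-low κʳ β (v xor β (κ⁻ i)) (κ⁻ i))
            (trans (sym (·-xor v (β (κ⁻ i)) _)) (cong (v ·_) (trans (·-self (β (κ⁻ i)) _) (cong low (inverseʳ κ)))))

  extend-injective : ∀ {κ κ′ β β′} → extend κ β ≗ extend κ′ β′ → κ ≗ κ′ × β ≗ β′
  extend-injective {κ} {κ′} {β} {β′} h = (λ i → proj₂ (both i)) , λ i → proj₁ (both i)
    where
    both : ∀ i → β i ≡ β′ i × κ i ≡ κ′ i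
    both i = signed-low-injective (β i) (β′ i)
      (trans (sym (extend-low κ β false i)) (trans (h (low i)) (extend-low κ′ β′ false i)))

  symPerm-low : {π : Fin n → Fin n} → IsSymPerm π → ∀ i → ∃ λ j → ∃ λ v → π (low i) ≡ v · low j
  symPerm-low {π} ((σ , σπ , _) , symm) i with classify (π (low i))
  ... | inj₁ found = found
  ... | inj₂ e = ⊥-elim (low-moved false i (trans (sym (σπ (low i))) (trans (cong σ (trans e (sym (symm (low i) _ refl)))) (σπ _))))

  extend-onto : {π : Fin n → Fin n} → IsSymPerm π →
    ∃ λ (κ : Permutation′ k) → ∃ λ (β : Fin k → Bool) → extend (κ ⟨$⟩ʳ_) β ≗ π
  extend-onto {π} s@((σ , σπ , πσ) , symm) =
    permutation (κ s) (κ s⁻) (λ j → cancel s⁻ s πσ j) (λ i → cancel s s⁻ σπ i) , β s , agree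
    where
    s⁻ = symPerm-inverse s
    κ : {π : Fin n → Fin n} → IsSymPerm π → Fin k → Fin k
    κ s i = proj₁ (symPerm-low s i)
    β : {π : Fin n → Fin n} → IsSymPerm π → Fin k → Bool
    β s i = proj₁ (proj₂ (symPerm-low s i))
    value : {π : Fin n → Fin n} (s : IsSymPerm π) → ∀ i → π (low i) ≡ β s i · low (κ s i)
    value s i = proj₂ (proj₂ (symPerm-low s i))
    cancel : {π σ : Fin n → Fin n} (s : IsSymPerm π) (s′ : IsSymPerm σ) → (∀ a → σ (π a) ≡ a) → ∀ i → κ s′ (κ s i) ≡ i
    cancel {π} {σ} s s′ σπ i = sym (proj₂ (signed-low-injective false (β s i xor β s′ (κ s i))
      (trans (sym (σπ (low i))) (trans (cong σ (value s i)) (trans (symPerm-· s′ (β s i) _)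
      (trans (cong (β s i ·_) (value s′ (κ s i))) (·-xor (β s i) _ _)))))))
    agree : ∀ a → extend (κ s) (β s) a ≡ π a
    agree a with classify a
    ... | inj₁ (i , v , refl) = trans (sym (·-xor v (β s i) _)) (trans (cong (v ·_) (sym (value s i))) (sym (symPerm-· s v (low i))))
    -- π commutes with reflection, so π a is fixed again and must be a.
    ... | inj₂ e = fixed-unique e (trans (cong π e) (symm a _ refl))

half-bounds : ∀ n → n / 2 + n / 2 ≤ n × n ≤ suc (n / 2 + n / 2)
half-bounds n =
  ℕ.≤-trans (ℕ.m≤n+m (k + k) (n % 2)) (ℕ.≤-reflexive (sym n≡)) ,
  ℕ.≤-trans (ℕ.≤-reflexive n≡) (ℕ.+-monoˡ-≤ (k + k) (ℕ.≤-pred (m%n<n n 2)))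
  where
  k = n / 2
  n≡ : n ≡ n % 2 + (k + k)
  n≡ = trans (m≡m%n+[m/n]*n n 2) (cong (n % 2 +_) (trans (ℕ.*-comm k 2) (cong (k +_) (ℕ.+-identityʳ k))))

-- The order of the group

-- There are 2^e · 2^k · (e+1)! · k! of these; here d = e + 1 and k = ⌊n/2⌋.
record Code (e k : ℕ) : Set where
  field
    signs : Fin e → Bool
    turns : Fin k → Bool
    axes  : Permutation′ (suc e)
    pairs : Permutation′ k

record _≈ᶜ_ {e k : ℕ} (x y : Code e k) : Set where
  private
    module X = Code x
    module Y = Code y
  field
    signs≗ : X.signs ≗ Y.signs
    turns≗ : X.turns ≗ Y.turns
    axes≈  : X.axes ≈ Y.axes
    pairs≈ : X.pairs ≈ Y.pairs

-- Signs and turns share one block of e + k bits, to match the factor 2^(d-1+k).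
module Coding (e k : ℕ) where
  private
    B = 2 ^ (e + k)
    T = suc e !

  bit-code : Fin (B * T * k !) → Fin B
  bit-code c = proj₁ (remQuot {B} T (proj₁ (remQuot {B * T} (k !) c)))

  axes-code : Fin (B * T * k !) → Fin T
  axes-code c = proj₂ (remQuot {B} T (proj₁ (remQuot {B * T} (k !) c)))

  pairs-code : Fin (B * T * k !) → Fin (k !)
  pairs-code c = proj₂ (remQuot {B * T} (k !) c)

  decode : Fin (B * T * k !) → Code e k
  decode c = record
    { signs = λ j → bits (e + k) (bit-code c) (j ↑ˡ k)
    ; turns = λ i → bits (e + k) (bit-code c) (e ↑ʳ i)
    ; axes  = perm (suc e) (axes-code c)
    ; pairs = perm k (pairs-code c) }

  decode-injective : ∀ c c′ → decode c ≈ᶜ decode c′ → c ≡ c′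
  decode-injective c c′ eq = remQuot-injective (B * T) (k !) c c′
    (remQuot-injective B T _ _ (bits-injective (e + k) (bit-code c) (bit-code c′) bits≗)
      (perm-injective (suc e) (axes-code c) (axes-code c′) axes≈))
    (perm-injective k (pairs-code c) (pairs-code c′) pairs≈)
    where
    open _≈ᶜ_ eq
    bits≗ : bits (e + k) (bit-code c) ≗ bits (e + k) (bit-code c′)
    bits≗ i = subst (λ i → bits (e + k) (bit-code c) i ≡ bits (e + k) (bit-code c′) i) (join-splitAt e k i) (go (splitAt e i))
      where
      go : ∀ s → bits (e + k) (bit-code c) (join e k s) ≡ bits (e + k) (bit-code c′) (join e k s)
      go (inj₁ j) = signs≗ j
      go (inj₂ i) = turns≗ i

  decode-onto : ∀ x → ∃ λ c → decode c ≈ᶜ x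
  decode-onto x = c , record
    { signs≗ = λ j → trans (bits≗ (j ↑ˡ k)) (cong wanted (splitAt-↑ˡ e j k))
    ; turns≗ = λ i → trans (bits≗ (e ↑ʳ i)) (cong wanted (splitAt-↑ʳ e k i))
    ; axes≈  = λ j → trans (cong (λ t → perm (suc e) t ⟨$⟩ʳ j) (cong proj₂ inner≡)) (proj₂ axes∃ j)
    ; pairs≈ = λ i → trans (cong (λ t → perm k t ⟨$⟩ʳ i) (cong proj₂ outer≡)) (proj₂ pairs∃ i) }
    where
    open Code x
    wanted : Fin e ⊎ Fin k → Bool
    wanted (inj₁ j) = signs j
    wanted (inj₂ i) = turns i
    bits∃ = bits-onto (e + k) (wanted ∘ splitAt e)
    axes∃ = perm-onto (suc e) axes
    pairs∃ = perm-onto k pairs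
    inner : Fin (B * T)
    inner = combine (proj₁ bits∃) (proj₁ axes∃)
    c : Fin (B * T * k !)
    c = combine inner (proj₁ pairs∃)
    outer≡ : remQuot {B * T} (k !) c ≡ (inner , proj₁ pairs∃)
    outer≡ = remQuot-combine {B * T} {k !} inner (proj₁ pairs∃)
    inner≡ : remQuot {B} T (proj₁ (remQuot {B * T} (k !) c)) ≡ (proj₁ bits∃ , proj₁ axes∃)
    inner≡ = trans (cong (λ q → remQuot {B} T (proj₁ q)) outer≡) (remQuot-combine {B} {T} (proj₁ bits∃) (proj₁ axes∃))
    bits≗ : ∀ i → bits (e + k) (bit-code c) i ≡ wanted (splitAt e i)
    bits≗ i = trans (cong (λ b → bits (e + k) b i) (cong proj₁ inner≡)) (proj₂ bits∃ i)

module Elements (n e k : ℕ) (2k≤n : k + k ≤ n) (n≤2k+1 : n ≤ suc (k + k)) (n≥3 : 3 ≤ n) where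
  open Halves n k 2k≤n n≤2k+1

  -- Changing all signs amounts to composing π with the reflection, so the sign of the
  -- first coordinate can be fixed.
  first-positive : (Fin e → Bool) → Fin (suc e) → Bool
  first-positive η zero    = false
  first-positive η (suc j) = η j

  module _ (x : Code e k) where
    open Code x
    ε : Fin (suc e) → Bool
    ε = first-positive signs

    π : Fin n → Fin n
    π = extend (pairs ⟨$⟩ʳ_) turns

    element : LineAut n (suc e)
    element = signedAut ε (axes ⟨$⟩ʳ_) (axes ⟨$⟩ˡ_) (λ _ → inverseʳ axes) (λ _ → inverseˡ axes)
              ∘ᴸ FAut (extend-symPerm pairs turns)

    element-at : ∀ p j → lookup (LineAut.to element p) j ≡ ε j · π (lookup p (axes ⟨$⟩ʳ j))
    element-at p j = trans (lookup-signed ε (axes ⟨$⟩ʳ_) (F π p) j) (cong (ε j ·_) (lookup-map (axes ⟨$⟩ʳ j) π p))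

  -- Constant points recover π at coordinate 0, where the sign is positive, and then the other
  -- signs. A point with a single reflected coordinate recovers the axes.
  element-injective : ∀ x y → LineAut.to (element x) ≗ₚ LineAut.to (element y) → x ≈ᶜ y
  element-injective x y h = record
    { signs≗ = λ j → ε≗ (suc j) ; turns≗ = proj₂ κβ≗ ; axes≈ = τ≗ ; pairs≈ = proj₁ κβ≗ }
    where
    open Code
    at : ∀ p j → ε x j · π x (lookup p (axes x ⟨$⟩ʳ j)) ≡ ε y j · π y (lookup p (axes y ⟨$⟩ʳ j))
    at p j = trans (sym (element-at x p j)) (trans (cong (λ q → lookup q j) (h p)) (element-at y p j))
    at-constant : ∀ t j → ε x j · π x t ≡ ε y j · π y t
    at-constant t j = subst₂ (λ a b → ε x j · π x a ≡ ε y j · π y b)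
      (lookup-replicate (axes x ⟨$⟩ʳ j) t) (lookup-replicate (axes y ⟨$⟩ʳ j) t) (at (replicate (suc e) t) j)
    π≗ : π x ≗ π y
    π≗ t = at-constant t zero
    κβ≗ = extend-injective π≗
    π-sym : IsSymPerm (π x)
    π-sym = extend-symPerm (pairs x) (turns x)
    π-injective : ∀ {a b} → π x a ≡ π x b → a ≡ b
    π-injective {a} {b} eq = let (σ , σπ , _) , _ = π-sym in trans (sym (σπ a)) (trans (cong σ eq) (σπ b))
    t₀ = proj₁ (zero-moved n≥3)
    t₀-moved = proj₂ (zero-moved n≥3)
    ε≗ : ε x ≗ ε y
    ε≗ j = sign-unique (ε x j) (ε y j) (λ eq → t₀-moved (π-injective (trans eq (sym (symPerm-· π-sym true t₀)))))
      (trans (at-constant t₀ j) (cong (ε y j ·_) (sym (π≗ t₀))))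
    τ≗ : axes x ≈ axes y
    τ≗ j with axes x ⟨$⟩ʳ j ≟ axes y ⟨$⟩ʳ j
    ... | yes eq = eq
    ... | no ne = ⊥-elim (t₀-moved (trans (sym at-y) (trans (sym same-value) at-x)))
      where
      p₀ : Point n (suc e)
      p₀ = replicate (suc e) t₀
      p = p₀ [ axes x ⟨$⟩ʳ j ]≔ opposite t₀
      at-x : lookup p (axes x ⟨$⟩ʳ j) ≡ opposite t₀
      at-x = lookup∘update (axes x ⟨$⟩ʳ j) p₀ (opposite t₀)
      at-y : lookup p (axes y ⟨$⟩ʳ j) ≡ t₀
      at-y = trans (lookup∘update′ (ne ∘ sym) p₀ (opposite t₀)) (lookup-replicate (axes y ⟨$⟩ʳ j) t₀)
      same-value : lookup p (axes x ⟨$⟩ʳ j) ≡ lookup p (axes y ⟨$⟩ʳ j)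
      same-value = π-injective (·-injective (ε x j) (trans (at p j)
        (cong₂ _·_ (sym (ε≗ j)) (sym (π≗ (lookup p (axes y ⟨$⟩ʳ j)))))))

  -- The sign at coordinate 0 is moved from all signs into π. The conclusion covers every y
  -- equivalent to x because `decode` is onto only up to `_≈ᶜ_`.
  element-onto : {f : Point n (suc e) → Point n (suc e)} → Standard f →
    ∃ λ x → ∀ y → y ≈ᶜ x → LineAut.to (element y) ≗ₚ f
  element-onto {f} st = code , λ y y≈ p → trans (lookup-ext λ j → trans (element-at y p j) (sym (target y y≈ p j))) (sym (Std.form p))
    where
    module Std = Standard st
    ε₀ = Std.ε zero
    π′-symPerm : IsSymPerm (λ a → ε₀ · Std.π a)
    π′-symPerm = let (σ , σπ , πσ) , symm = Std.π-symPerm in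
      ((λ b → σ (ε₀ · b)) , (λ a → trans (cong σ (·-self ε₀ (Std.π a))) (σπ a)) ,
        (λ b → trans (cong (ε₀ ·_) (πσ (ε₀ · b))) (·-self ε₀ b))) ,
      λ { p _ refl → trans (cong (ε₀ ·_) (symm p _ refl)) (·-comm-opposite ε₀ (Std.π p)) }
    halves = extend-onto π′-symPerm
    code : Code e k
    code = record
      { signs = λ j → Std.ε (suc j) xor ε₀ ; turns = proj₁ (proj₂ halves)
      ; axes = permutation Std.τ Std.τ⁻ Std.ττ⁻ Std.τ⁻τ ; pairs = proj₁ halves }
    module _ (y : Code e k) (y≈ : y ≈ᶜ code) where
      open _≈ᶜ_ y≈
      ε≗ : ∀ j → ε y j ≡ Std.ε j xor ε₀
      ε≗ zero    = sym (xor-same ε₀)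
      ε≗ (suc j) = signs≗ j
      π≗ : ∀ a → π y a ≡ ε₀ · Std.π a
      π≗ a = trans (extend-cong a) (proj₂ (proj₂ halves) a)
        where
        extend-cong : π y ≗ π code
        extend-cong a with classify a
        ... | inj₂ _           = refl
        ... | inj₁ (i , v , _) = cong₂ (λ u j → (v xor u) · low j) (turns≗ i) (pairs≈ i)
      target : ∀ p j → lookup (signed Std.ε Std.τ (F Std.π p)) j ≡ ε y j · π y (lookup p (Code.axes y ⟨$⟩ʳ j))
      target p j = trans (lookup-signed Std.ε Std.τ (F Std.π p) j) (trans (cong (Std.ε j ·_) (lookup-map (Std.τ j) Std.π p)) (sym
        (trans (cong₂ _·_ (ε≗ j) (trans (π≗ _) (cong (λ i → ε₀ · Std.π (lookup p i)) (axes≈ j))))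
        (trans (sym (·-xor (Std.ε j) ε₀ _)) (cong (Std.ε j ·_) (·-self ε₀ _))))))

has-order : ∀ e → 3 ≤ n → 2 ≤ suc e → HasOrder n (suc e) (2 ^ (e + n / 2) * suc e ! * (n / 2) !)
has-order {n} e n≥3 d≥2 =
  (λ c → record { fun = LineAut.to (element (decode c)) ; isAut = LineAut⇒isAut n≥3 (element (decode c)) }) ,
  (λ c c′ h → decode-injective c c′ (element-injective (decode c) (decode c′) h)) ,
  λ P → let x , onto = element-onto (standard n≥3 d≥2 (isAut⇒LineAut n≥3 (Aut.isAut P)))
            c , c≈x = decode-onto x
        in c , onto (decode c) c≈x
  where
  open Coding e (n / 2)
  open Elements n e (n / 2) (proj₁ (half-bounds n)) (proj₂ (half-bounds n)) n≥3

theorem1 : ∀ (n d : ℕ) → 3 ≤ n → 2 ≤ d →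
    ((∀ (f : Point n d → Point n d) → Generated n d f → IsAut f)
    × (∀ (P : Point n d → Point n d) → IsAut P → ∃ λ f → Generated n d f × f ≗ₚ P))
    × HasOrder n d (2 ^ (d ∸ 1 + n / 2) * d ! * (n / 2) !)
theorem1 n d@(suc _) n≥3 d≥2 =
  ((λ f gen → let perm , pres = generated-preserves gen in preserves⇒isAut n≥3 perm pres) ,
   λ P aut → standard-generable d≥2 (standard n≥3 d≥2 (isAut⇒LineAut n≥3 aut))) ,
  has-order _ n≥3 d≥2
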